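{- For all integers $r\ge 2$ and $d\ge 1$, with $N=(r-1)(d+1)$, there exists an $\mathfrak{S}_r$-equivariant continuous map $$F:(\Delta_{r,r})^{*(d+1)}\longrightarrow W_r^{\oplus(d+1)}\setminus\{0\}\ \simeq\ S^{N-1}.$$
   Context: $\mathfrak{S}_r$ is the symmetric group on $r$ letters. The chessboard complex $\Delta_{m,n}$ is the simplicial complex with vertex set $\{1,\dots,m\}\times\{1,\dots,n\}$ ($m$ rows, $n$ columns) whose simplices are the sets of vertices no two of which lie in the same row or in the same column. $\mathfrak{S}_r$ acts on $\Delta_{r,n}$ by permuting the $r$ rows, and diagonally on joins of such complexes; $K^{*(d+1)}$ denotes the $(d+1)$-fold join of $K$ with itself. $W_r=\{(\xi_1,\dots,\xi_r)\in\mathbb{R}^r:\xi_1+\dots+\xi_r=0\}$ is the $(r-1)$-dimensional real representation of $\mathfrak{S}_r$ given by permuting coordinates; $W_r^{\oplus(d+1)}$ is identified with the space of real $r\times(d+1)$ matrices with all column sums zero, on which $\mathfrak{S}_r$ acts by permuting rows. -}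

module Defs where

open import Algebra.Bundles using (CommutativeMonoid)
import Algebra.Properties.CommutativeMonoid.Sum as Sum
open import Data.Bool.Base using (Bool; T)
open import Data.Fin.Base using (Fin)
open import Data.Fin.Permutation using (Permutation′; _⟨$⟩ʳ_; _⟨$⟩ˡ_)
open import Data.Fin.Properties using (*↔×)
open import Data.Nat.Base as ℕ using (ℕ)
import Data.Nat.Properties as ℕ
open import Data.Product.Base using (Σ; _×_; _,_; proj₁; proj₂; ∃; ∃-syntax)
open import Data.Product.Function.NonDependent.Propositional using (_×-↔_)
open import Data.Rational.Base as ℚ using (ℚ; 0ℚ; 1ℚ; ½)
import Data.Rational.Properties as ℚ
open import Data.Rational.Solver using (module +-*-Solver)
open import Data.Sum.Base using (_⊎_; inj₁; inj₂; [_,_]′)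
open import Data.Unit.Base using (⊤; tt)
open import Function.Base using (_∘_; id)
open import Function.Bundles using (_↔_; module Inverse)
open import Function.Construct.Composition using (_↔-∘_)
open import Function.Construct.Identity using (↔-id)
open import Function.Construct.Symmetry using (↔-sym)
open import Level using (0ℓ)
open import Relation.Binary.PropositionalEquality
  using (_≡_; _≢_; refl; sym; trans; cong; cong₂; subst)
open import Relation.Nullary.Negation using (¬_)

private
  half⁺ : ∀ {ε} → 0ℚ ℚ.< ε → 0ℚ ℚ.< ½ ℚ.* ε
  half⁺ {ε} 0<ε = subst (ℚ._< ½ ℚ.* ε) (ℚ.*-zeroʳ ½) (ℚ.*-monoʳ-<-pos ½ 0<ε)

  halves : ∀ ε → ½ ℚ.* ε ℚ.+ ½ ℚ.* ε ≡ ε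
  halves ε = trans (sym (ℚ.*-distribʳ-+ ε ½ ½)) (ℚ.*-identityˡ ε)

  divide : ∀ {B ε} → 0ℚ ℚ.< B → 0ℚ ℚ.< ε → ∃[ δ ] 0ℚ ℚ.< δ × B ℚ.* δ ≡ ε
  divide {B} {ε} 0<B 0<ε = ε ℚ.* 1/B , 0<δ , eq
    where
    instance
      B⁺ : ℚ.Positive B
      B⁺ = ℚ.positive 0<B
      B≢0 : ℚ.NonZero B
      B≢0 = ℚ.pos⇒nonZero B
    1/B = ℚ.1/ B
    0<δ : 0ℚ ℚ.< ε ℚ.* 1/B
    0<δ = subst (ℚ._< ε ℚ.* 1/B) (ℚ.*-zeroˡ 1/B)
            (ℚ.*-monoˡ-<-pos 1/B {{ℚ.1/pos⇒pos B}} 0<ε)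
    eq : B ℚ.* (ε ℚ.* 1/B) ≡ ε
    eq = trans (solve 3 (λ b e i → b :* (e :* i) := e :* (b :* i)) refl B ε 1/B)
           (trans (cong (ε ℚ.*_) (ℚ.*-inverseʳ B)) (ℚ.*-identityʳ ε))
      where open +-*-Solver

  ∣+∣< : ∀ {ε a b} → ℚ.∣ a ∣ ℚ.< ½ ℚ.* ε → ℚ.∣ b ∣ ℚ.< ½ ℚ.* ε → ℚ.∣ a ℚ.+ b ∣ ℚ.< ε
  ∣+∣< {ε} {a} {b} p q =
    ℚ.≤-<-trans (ℚ.∣p+q∣≤∣p∣+∣q∣ a b)
      (subst (ℚ.∣ a ∣ ℚ.+ ℚ.∣ b ∣ ℚ.<_) (halves ε) (ℚ.+-mono-< p q))

  ∣*∣< : ∀ {A a b δ} → 0ℚ ℚ.< A → ℚ.∣ a ∣ ℚ.≤ A → ℚ.∣ b ∣ ℚ.< δ → ℚ.∣ a ℚ.* b ∣ ℚ.< A ℚ.* δ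
  ∣*∣< {A} {a} {b} {δ} 0<A a≤A b<δ =
    subst (ℚ._< A ℚ.* δ) (sym (ℚ.∣p*q∣≡∣p∣*∣q∣ a b))
      (ℚ.≤-<-trans (ℚ.*-monoʳ-≤-nonNeg ℚ.∣ b ∣ {{ℚ.∣-∣-nonNeg b}} a≤A)
                   (ℚ.*-monoʳ-<-pos A {{ℚ.positive 0<A}} b<δ))

  ∣-∣-sym : ∀ a b → ℚ.∣ a ℚ.- b ∣ ≡ ℚ.∣ b ℚ.- a ∣
  ∣-∣-sym a b = trans (sym (ℚ.∣-p∣≡∣p∣ (a ℚ.- b)))
    (cong ℚ.∣_∣ (solve 2 (λ a b → :- (a :- b) := b :- a) refl a b))
    where open +-*-Solver

-- Real numbers are Cauchy sequences of rationals, considered up to _≈_.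

IsCauchy : (ℕ → ℚ) → Set
IsCauchy s = ∀ ε → 0ℚ ℚ.< ε →
  ∃[ k ] ∀ m n → k ℕ.≤ m → k ℕ.≤ n → ℚ.∣ s m ℚ.- s n ∣ ℚ.< ε

-- no-eta-equality and the abstract Cauchy proofs below keep normal forms small.
record ℝ : Set where
  no-eta-equality
  constructor mkℝ
  field
    seq    : ℕ → ℚ
    cauchy : IsCauchy seq

open ℝ public

infix 4 _≈_ _<_ _≤_ _#_

record _≈_ (x y : ℝ) : Set where
  constructor mk≈
  field
    difference→0 : ∀ ε → 0ℚ ℚ.< ε →
      ∃[ k ] ∀ n → k ℕ.≤ n → ℚ.∣ seq x n ℚ.- seq y n ∣ ℚ.< ε

open _≈_ public

record _<_ (x y : ℝ) : Set where
  constructor mk<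
  field
    gap        : ℚ
    gap>0      : 0ℚ ℚ.< gap
    from       : ℕ
    separation : ∀ n → from ℕ.≤ n → seq x n ℚ.+ gap ℚ.≤ seq y n

_≤_ : ℝ → ℝ → Set
x ≤ y = ¬ (y < x)

-- The constructive (positive) form of x ≠ y.
_#_ : ℝ → ℝ → Set
x # y = x < y ⊎ y < x

abstract
  private
    const-cauchy : ∀ q → IsCauchy (λ _ → q)
    const-cauchy q = λ ε 0<ε → 0 , λ _ _ _ _ →
      subst (λ z → ℚ.∣ z ∣ ℚ.< ε) (sym (ℚ.+-inverseʳ q)) 0<ε

fromℚ : ℚ → ℝ
fromℚ q = mkℝ (λ _ → q) (const-cauchy q)

0ℝ 1ℝ : ℝ
0ℝ = fromℚ 0ℚ
1ℝ = fromℚ 1ℚ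

infixl 6 _+_ _-_
infixl 7 _*_
infix  8 -_

abstract
  private
    +-cauchy : ∀ x y → IsCauchy (λ n → seq x n ℚ.+ seq y n)
    +-cauchy x y = λ ε 0<ε →
      let (j , p) = cauchy x (½ ℚ.* ε) (half⁺ 0<ε)
          (k , q) = cauchy y (½ ℚ.* ε) (half⁺ 0<ε)
      in j ℕ.⊔ k , λ m n m≥ n≥ →
         subst (λ z → ℚ.∣ z ∣ ℚ.< ε)
           (solve 4 (λ a b c d → (a :- b) :+ (c :- d) := (a :+ c) :- (b :+ d)) refl
              (seq x m) (seq x n) (seq y m) (seq y n))
           (∣+∣< (p m n (ℕ.m⊔n≤o⇒m≤o j k m≥) (ℕ.m⊔n≤o⇒m≤o j k n≥))
                 (q m n (ℕ.m⊔n≤o⇒n≤o j k m≥) (ℕ.m⊔n≤o⇒n≤o j k n≥)))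
      where open +-*-Solver

_+_ : ℝ → ℝ → ℝ
x + y = mkℝ (λ n → seq x n ℚ.+ seq y n) (+-cauchy x y)

abstract
  private
    neg-cauchy : ∀ x → IsCauchy (λ n → ℚ.- seq x n)
    neg-cauchy x = λ ε 0<ε →
      let (k , p) = cauchy x ε 0<ε
      in k , λ m n m≥ n≥ →
         subst (ℚ._< ε)
           (trans (∣-∣-sym (seq x m) (seq x n))
             (cong ℚ.∣_∣ (solve 2 (λ a b → b :- a := (:- a) :- (:- b)) refl (seq x m) (seq x n))))
           (p m n m≥ n≥)
      where open +-*-Solver

-_ : ℝ → ℝ
- x = mkℝ (λ n → ℚ.- seq x n) (neg-cauchy x)

_-_ : ℝ → ℝ → ℝ
x - y = x + (- y)

private
  eventuallyBounded : ∀ x → ∃[ B ] 0ℚ ℚ.< B × ∃[ k ] ∀ n → k ℕ.≤ n → ℚ.∣ seq x n ∣ ℚ.≤ B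
  eventuallyBounded x with cauchy x 1ℚ (ℚ.positive⁻¹ 1ℚ)
  ... | k , p = 1ℚ ℚ.+ ℚ.∣ seq x k ∣
              , ℚ.+-mono-<-≤ (ℚ.positive⁻¹ 1ℚ) (ℚ.0≤∣p∣ (seq x k))
              , k , λ n k≤n → ℚ.≤-trans
                  (subst (λ z → ℚ.∣ z ∣ ℚ.≤ ℚ.∣ seq x n ℚ.- seq x k ∣ ℚ.+ ℚ.∣ seq x k ∣)
                     (solve 2 (λ a b → (a :- b) :+ b := a) refl (seq x n) (seq x k))
                     (ℚ.∣p+q∣≤∣p∣+∣q∣ (seq x n ℚ.- seq x k) (seq x k)))
                  (ℚ.+-monoˡ-≤ ℚ.∣ seq x k ∣ (ℚ.<⇒≤ (p n k k≤n ℕ.≤-refl)))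
    where open +-*-Solver

abstract
  private
    *-cauchy : ∀ x y → IsCauchy (λ n → seq x n ℚ.* seq y n)
    *-cauchy x y = λ ε 0<ε →
      let (A , 0<A , a , x≤A)   = eventuallyBounded x
          (B , 0<B , b , y≤B)   = eventuallyBounded y
          (δ , 0<δ , Aδ≡ε/2)    = divide 0<A (half⁺ 0<ε)
          (η , 0<η , Bη≡ε/2)    = divide 0<B (half⁺ 0<ε)
          (j , p)               = cauchy x η 0<η
          (k , q)               = cauchy y δ 0<δ
          l                     = a ℕ.⊔ b
          i                     = j ℕ.⊔ k
          l≤ : ∀ {n} → l ℕ.⊔ i ℕ.≤ n → l ℕ.≤ n
          l≤ = ℕ.m⊔n≤o⇒m≤o l i
          i≤ : ∀ {n} → l ℕ.⊔ i ℕ.≤ n → i ℕ.≤ n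
          i≤ = ℕ.m⊔n≤o⇒n≤o l i
      in l ℕ.⊔ i , λ m n m≥ n≥ →
         subst (λ z → ℚ.∣ z ∣ ℚ.< ε)
           (solve 4 (λ s t u v → s :* (u :- v) :+ v :* (s :- t) := s :* u :- t :* v) refl
              (seq x m) (seq x n) (seq y m) (seq y n))
           (∣+∣<
             (subst (ℚ.∣ seq x m ℚ.* (seq y m ℚ.- seq y n) ∣ ℚ.<_) Aδ≡ε/2
               (∣*∣< 0<A (x≤A m (ℕ.m⊔n≤o⇒m≤o a b (l≤ m≥)))
                 (q m n (ℕ.m⊔n≤o⇒n≤o j k (i≤ m≥)) (ℕ.m⊔n≤o⇒n≤o j k (i≤ n≥)))))
             (subst (ℚ.∣ seq y n ℚ.* (seq x m ℚ.- seq x n) ∣ ℚ.<_) Bη≡ε/2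
               (∣*∣< 0<B (y≤B n (ℕ.m⊔n≤o⇒n≤o a b (l≤ n≥)))
                 (p m n (ℕ.m⊔n≤o⇒m≤o j k (i≤ m≥)) (ℕ.m⊔n≤o⇒m≤o j k (i≤ n≥))))))
      where open +-*-Solver

_*_ : ℝ → ℝ → ℝ
x * y = mkℝ (λ n → seq x n ℚ.* seq y n) (*-cauchy x y)

≈-refl : ∀ {x} → x ≈ x
≈-refl {x} = mk≈ λ ε 0<ε → 0 , λ n _ →
  subst (λ z → ℚ.∣ z ∣ ℚ.< ε) (sym (ℚ.+-inverseʳ (seq x n))) 0<ε

≈-sym : ∀ {x y} → x ≈ y → y ≈ x
≈-sym {x} {y} (mk≈ h) = mk≈ λ ε 0<ε → let (k , p) = h ε 0<ε in
  k , λ n k≤n → subst (ℚ._< ε) (∣-∣-sym (seq x n) (seq y n)) (p n k≤n)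

≈-trans : ∀ {x y z} → x ≈ y → y ≈ z → x ≈ z
≈-trans {x} {y} {z} (mk≈ g) (mk≈ h) = mk≈ λ ε 0<ε →
  let (j , p) = g (½ ℚ.* ε) (half⁺ 0<ε)
      (k , q) = h (½ ℚ.* ε) (half⁺ 0<ε)
  in j ℕ.⊔ k , λ n n≥ → subst (λ w → ℚ.∣ w ∣ ℚ.< ε)
       (solve 3 (λ a b c → (a :- b) :+ (b :- c) := a :- c) refl (seq x n) (seq y n) (seq z n))
       (∣+∣< (p n (ℕ.m⊔n≤o⇒m≤o j k n≥)) (q n (ℕ.m⊔n≤o⇒n≤o j k n≥)))
  where open +-*-Solver

private
  pointwise : ∀ {x y} → (∀ n → seq x n ≡ seq y n) → x ≈ y
  pointwise {x} {y} eq = mk≈ λ ε 0<ε → 0 , λ n _ →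
    subst (λ z → ℚ.∣ z ∣ ℚ.< ε)
      (sym (trans (cong (ℚ._- seq y n) (eq n)) (ℚ.+-inverseʳ (seq y n)))) 0<ε

+-cong : ∀ {x y u v} → x ≈ y → u ≈ v → x + u ≈ y + v
+-cong {x} {y} {u} {v} (mk≈ g) (mk≈ h) = mk≈ λ ε 0<ε →
  let (j , p) = g (½ ℚ.* ε) (half⁺ 0<ε)
      (k , q) = h (½ ℚ.* ε) (half⁺ 0<ε)
  in j ℕ.⊔ k , λ n n≥ → subst (λ w → ℚ.∣ w ∣ ℚ.< ε)
       (solve 4 (λ a b c d → (a :- b) :+ (c :- d) := (a :+ c) :- (b :+ d)) refl
          (seq x n) (seq y n) (seq u n) (seq v n))
       (∣+∣< (p n (ℕ.m⊔n≤o⇒m≤o j k n≥)) (q n (ℕ.m⊔n≤o⇒n≤o j k n≥)))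
  where open +-*-Solver

+-0-commutativeMonoid : CommutativeMonoid 0ℓ 0ℓ
+-0-commutativeMonoid = record
  { Carrier = ℝ
  ; _≈_     = _≈_
  ; _∙_     = _+_
  ; ε       = 0ℝ
  ; isCommutativeMonoid = record
    { isMonoid = record
      { isSemigroup = record
        { isMagma = record
          { isEquivalence = record { refl = ≈-refl ; sym = ≈-sym ; trans = ≈-trans }
          ; ∙-cong        = +-cong
          }
        ; assoc = λ x y z → pointwise λ n → ℚ.+-assoc (seq x n) (seq y n) (seq z n)
        }
      ; identity = (λ x → pointwise λ n → ℚ.+-identityˡ (seq x n))
                 , (λ x → pointwise λ n → ℚ.+-identityʳ (seq x n))
      }
    ; comm = λ x y → pointwise λ n → ℚ.+-comm (seq x n) (seq y n)
    }
  }

open Sum +-0-commutativeMonoid public using (sum; sum-permute; sum-cong-≗)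

-- Subspaces of ℝ^Index.  Index is finite in every space below, so the
-- sup-distance induces the usual topology.  A continuous map
-- automatically respects _≋_.

record Space : Set₁ where
  field
    Point : Set
    Index : Set
    coord : Point → Index → ℝ

  infix 4 _≋_

  _≋_ : Point → Point → Set
  x ≋ y = ∀ i → coord x i ≈ coord y i

  Within : ℝ → Point → Point → Set
  Within ε x y = ∀ i → coord x i - coord y i < ε × coord y i - coord x i < ε

open Space public using (Point; Index; coord)

module _ (X Y : Space) where

  Continuous : (Point X → Point Y) → Set
  Continuous f = ∀ x ε → 0ℝ < ε → ∃[ δ ] 0ℝ < δ ×
    (∀ y → Space.Within X δ x y → Space.Within Y ε (f x) (f y))

_⊗_ : Space → Space → Space
X ⊗ Y = record
  { Point = Point X × Point Y
  ; Index = Index X ⊎ Index Y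
  ; coord = λ (x , y) → [ coord X x , coord Y y ]′
  }

UnitInterval : Space
UnitInterval = record
  { Point = ∃[ t ] 0ℝ ≤ t × t ≤ 1ℝ
  ; Index = ⊤
  ; coord = λ (t , _) _ → t
  }

private
  <-irrefl : ∀ x → ¬ (x < x)
  <-irrefl x (mk< g g>0 k s) = ℚ.<-irrefl refl (ℚ.<-≤-trans
    (subst (ℚ._< seq x k ℚ.+ g) (ℚ.+-identityʳ (seq x k)) (ℚ.+-monoʳ-< (seq x k) g>0))
    (s k ℕ.≤-refl))

  0≤1 : 0ℝ ≤ 1ℝ
  0≤1 (mk< g g>0 k s) = ℚ.<-irrefl refl
    (ℚ.<-≤-trans (ℚ.+-mono-< (ℚ.positive⁻¹ 1ℚ) g>0) (s k ℕ.≤-refl))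

0ᴵ 1ᴵ : Point UnitInterval
0ᴵ = 0ℝ , <-irrefl 0ℝ , 0≤1
1ᴵ = 1ℝ , 0≤1 , <-irrefl 1ℝ

module _ (X Y : Space) where

  Homotopic : (f g : Point X → Point Y) → Set
  Homotopic f g = Σ (Point X × Point UnitInterval → Point Y) λ H →
    Continuous (X ⊗ UnitInterval) Y H ×
    (∀ x → Space._≋_ Y (H (x , 0ᴵ)) (f x)) ×
    (∀ x → Space._≋_ Y (H (x , 1ᴵ)) (g x))

infix 4 _≃_

_≃_ : Space → Space → Set
X ≃ Y = Σ (Point X → Point Y) λ f → Σ (Point Y → Point X) λ g →
  Continuous X Y f × Continuous Y X g ×
  Homotopic X X (g ∘ f) id × Homotopic Y Y (f ∘ g) id

-- The unit sphere of ℝⁿ, i.e. S^{n-1}.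
UnitSphere : ℕ → Space
UnitSphere n = record
  { Point = Σ (Fin n → ℝ) λ y → sum (λ i → y i * y i) ≈ 1ℝ
  ; Index = Fin n
  ; coord = proj₁
  }

-- Sets of vertices are given by their characteristic functions.

infix 4 _∈_ _⊆_

_∈_ : {V : Set} → V → (V → Bool) → Set
v ∈ σ = T (σ v)

_⊆_ : {V : Set} → (V → Bool) → (V → Bool) → Set
σ ⊆ τ = ∀ v → v ∈ σ → v ∈ τ

record SimplicialComplex : Set₁ where
  field
    Vertex     : Set
    order      : ℕ
    enum       : Fin order ↔ Vertex
    IsSimplex  : (Vertex → Bool) → Set
    downClosed : ∀ {σ τ} → τ ⊆ σ → IsSimplex σ → IsSimplex τ

open SimplicialComplex public

-- A vertex permutation σ ↦ π(σ) = σ ∘ π⁻¹ mapping simplices to simplices;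
-- by finiteness its inverse does so too.
record Automorphism (K : SimplicialComplex) : Set where
  field
    perm       : Vertex K ↔ Vertex K
    simplicial : ∀ {σ} → IsSimplex K σ → IsSimplex K (σ ∘ Inverse.from perm)

open Automorphism public

-- |K| as the union of its closed simplices, in barycentric coordinates.
record Realization (K : SimplicialComplex) : Set where
  field
    weight       : Vertex K → ℝ
    nonNegative  : ∀ v → 0ℝ ≤ weight v
    total        : sum (weight ∘ Inverse.to (enum K)) ≈ 1ℝ
    carrier      : Vertex K → Bool
    isSimplex    : IsSimplex K carrier
    supported    : ∀ v → ¬ (v ∈ carrier) → weight v ≈ 0ℝ

open Realization public

∣_∣ : SimplicialComplex → Space
∣ K ∣ = record
  { Point = Realization K
  ; Index = Vertex K
  ; coord = weight
  }

-- The affine extension φ x = Σ_v x_v φ(v), whose v-th weight is x_{φ⁻¹ v}.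
∣_∣∙_ : ∀ {K} → Automorphism K → Point ∣ K ∣ → Point ∣ K ∣
∣_∣∙_ {K} φ x = record
  { weight      = weight x ∘ φ⁻¹
  ; nonNegative = nonNegative x ∘ φ⁻¹
  ; total       = ≈-trans total-φ (total x)
  ; carrier     = carrier x ∘ φ⁻¹
  ; isSimplex   = simplicial φ (isSimplex x)
  ; supported   = supported x ∘ φ⁻¹
  }
  where
  φ⁻¹ = Inverse.from (perm φ)
  e   = Inverse.to (enum K)
  ρ : Fin (order K) ↔ Fin (order K)
  ρ = (↔-sym (enum K) ↔-∘ ↔-sym (perm φ)) ↔-∘ enum K
  eq : ∀ i → weight x (e (Inverse.to ρ i)) ≡ weight x (φ⁻¹ (e i))
  eq i = cong (weight x) (Inverse.strictlyInverseˡ (enum K) (φ⁻¹ (e i)))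
  total-φ : sum (weight x ∘ φ⁻¹ ∘ e) ≈ sum (weight x ∘ e)
  total-φ = ≈-sym (subst (sum (weight x ∘ e) ≈_) (sum-cong-≗ eq) (sum-permute (weight x ∘ e) ρ))

-- Δ_{m,n}, with rows Fin m and columns Fin n.
chessboard : ℕ → ℕ → SimplicialComplex
chessboard m n = record
  { Vertex     = Fin m × Fin n
  ; order      = m ℕ.* n
  ; enum       = *↔×
  ; IsSimplex  = λ σ → ∀ v w → v ∈ σ → w ∈ σ → v ≢ w →
                   proj₁ v ≢ proj₁ w × proj₂ v ≢ proj₂ w
  ; downClosed = λ τ⊆σ h v w v∈τ w∈τ → h v w (τ⊆σ v v∈τ) (τ⊆σ w w∈τ)
  }

-- The k-fold join K * … * K: its vertices are k disjoint copies of those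
-- of K, and its simplices σ₁ ⊔ … ⊔ σₖ have each (possibly empty) σᵢ a
-- simplex of the i-th copy.
joinPower : SimplicialComplex → ℕ → SimplicialComplex
joinPower K k = record
  { Vertex     = Fin k × Vertex K
  ; order      = k ℕ.* order K
  ; enum       = (↔-id (Fin k) ×-↔ enum K) ↔-∘ *↔×
  ; IsSimplex  = λ σ → ∀ i → IsSimplex K (λ v → σ (i , v))
  ; downClosed = λ τ⊆σ h i → downClosed K (λ v → τ⊆σ (i , v)) (h i)
  }

permuteRows : ∀ {m n} → Permutation′ m → Automorphism (chessboard m n)
permuteRows {m} {n} π = record
  { perm       = π ×-↔ ↔-id (Fin n)
  ; simplicial = λ h v w v∈ w∈ v≢w →
      let (r , c) = h _ _ v∈ w∈ (λ eq → v≢w (cong₂ _,_ (injective (cong proj₁ eq)) (cong proj₂ eq)))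
      in (λ eq → r (cong (π ⟨$⟩ˡ_) eq)) , c
  }
  where
  injective : ∀ {i j} → π ⟨$⟩ˡ i ≡ π ⟨$⟩ˡ j → i ≡ j
  injective {i} {j} eq =
    trans (sym (Inverse.strictlyInverseˡ π i))
      (trans (cong (π ⟨$⟩ʳ_) eq) (Inverse.strictlyInverseˡ π j))

diagonal : ∀ {K} k → Automorphism K → Automorphism (joinPower K k)
diagonal k φ = record
  { perm       = ↔-id (Fin k) ×-↔ perm φ
  ; simplicial = λ h i → simplicial φ (h i)
  }

-- W_r^{⊕k} ∖ {0} as the nonzero real r × k matrices with zero column sums;
-- being nonzero is the positive statement that some entry is apart from 0.

record NonzeroMatrix (r k : ℕ) : Set where
  field
    entry      : Fin r → Fin k → ℝ
    columnSums : ∀ j → sum (λ i → entry i j) ≈ 0ℝ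
    nonzero    : ∃[ i ] ∃[ j ] entry i j # 0ℝ

open NonzeroMatrix public

W^⊕_∖0 : ℕ → ℕ → Space
W^⊕_∖0 r k = record
  { Point = NonzeroMatrix r k
  ; Index = Fin r × Fin k
  ; coord = λ M (i , j) → entry M i j
  }

infixr 5 _∙_

-- Row i of π ∙ M is row π⁻¹ i of M.
_∙_ : ∀ {r k} → Permutation′ r → Point (W^⊕ r ∖0 k) → Point (W^⊕ r ∖0 k)
π ∙ M = record
  { entry      = λ i j → entry M (π ⟨$⟩ˡ i) j
  ; columnSums = λ j → ≈-trans (≈-sym (sum-permute (λ i → entry M i j) (↔-sym π))) (columnSums M j)
  ; nonzero    = let (i , j , Mij#0) = nonzero M in
      π ⟨$⟩ʳ i , j , subst (λ i → entry M i j # 0ℝ) (sym (Inverse.strictlyInverseʳ π i)) Mij#0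
  }

Equivariant : ∀ {r n k l} →
  (Point ∣ joinPower (chessboard r n) k ∣ → Point (W^⊕ r ∖0 l)) → Set
Equivariant {r} {n} {k} {l} F = ∀ (π : Permutation′ r) x →
  Space._≋_ (W^⊕ r ∖0 l) (F (∣ diagonal k (permuteRows π) ∣∙ x)) (π ∙ F x)

module Submission where

-- On a simplex of the chessboard complex every row and every column holds at
-- most one vertex.  Add up the weights in each row, counting column 0 with
-- sign + and the other columns with sign −, and project to W_r.  These signed
-- row sums are not all equal: a vertex in column 0 makes its row positive and
-- every other row nonpositive, while a vertex in another column makes its row
-- negative and some row must avoid the r − 1 other columns.  Applied to the
-- blocks of the join this is linear, equivariant and nowhere zero.
--
-- For the homotopy equivalence, forgetting row 0 identifies W_r^{⊕(d+1)} with
-- ℝ^N, and the nonzero vectors are normalised with a reciprocal square root.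

open import Data.Bool.Properties using (T?)
open import Data.Fin.Base using (Fin; zero; suc; combine; remQuot)
open import Data.Fin.Permutation using (_⟨$⟩ˡ_)
import Data.Fin.Properties as Fin
open import Data.Integer.Base as ℤ using (+_; +[1+_]; -[1+_])
import Data.Integer.Properties as ℤ
import Data.Integer.Solver as ℤ-Solver
open import Data.Nat.Base as ℕ using (ℕ; _∸_; zero; suc)
import Data.Nat.Coprimality as Coprime
import Data.Nat.Properties as ℕ
open import Data.Product.Base using (Σ; _×_; _,_; proj₁; proj₂; ∃-syntax)
open import Data.Rational.Base as ℚ using (ℚ; 0ℚ; 1ℚ; ½)
import Data.Rational.Properties as ℚ
open import Data.Rational.Solver using (module +-*-Solver)
import Data.Rational.Unnormalised.Base as ℚᵘ
import Data.Rational.Unnormalised.Properties as ℚᵘ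
open import Data.Sum.Base using (_⊎_; inj₁; inj₂; [_,_]′)
open import Function.Base using (_∘_; id)
open import Function.Bundles using (module Inverse)
open import Function.Construct.Symmetry using (↔-sym)
open import Relation.Binary.PropositionalEquality
  using (_≡_; _≢_; refl; sym; trans; cong; subst; subst₂)
open import Relation.Nullary using (¬_; yes; no; contradiction; ¬?)
open import Relation.Nullary.Decidable using (decidable-stable)

open +-*-Solver using (solve; con; _:+_; _:*_; _:-_; :-_; _:=_)

-- Inequalities between rationals, and rational approximations of 1/√q.

module Rationals where
  open import Data.Rational.Base

  -- The format of nearly all estimates below: the difference of the two sides is written as a
  -- visibly nonnegative `e`, and the ring solver checks the identity.
  ≤-by : ∀ {p q e} → 0ℚ ≤ e → p + e ≡ q → p ≤ q
  ≤-by {p} {q} 0≤e p+e≡q = subst₂ _≤_ (ℚ.+-identityʳ p) p+e≡q (ℚ.+-monoʳ-≤ p 0≤e)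

  <-by : ∀ {p q e} → 0ℚ < e → p + e ≡ q → p < q
  <-by {p} {q} 0<e p+e≡q = subst₂ _<_ (ℚ.+-identityʳ p) p+e≡q (ℚ.+-monoʳ-< p 0<e)

  0≤- : ∀ {p q} → p ≤ q → 0ℚ ≤ q - p
  0≤- {p} {q} p≤q = subst (_≤ q - p) (ℚ.+-inverseʳ p) (ℚ.+-monoˡ-≤ (- p) p≤q)

  0≤+ : ∀ {p q} → 0ℚ ≤ p → 0ℚ ≤ q → 0ℚ ≤ p + q
  0≤+ = ℚ.+-mono-≤

  0<+ : ∀ {p q} → 0ℚ < p → 0ℚ ≤ q → 0ℚ < p + q
  0<+ = ℚ.+-mono-<-≤

  0≤* : ∀ {p q} → 0ℚ ≤ p → 0ℚ ≤ q → 0ℚ ≤ p * q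
  0≤* {p} {q} 0≤p 0≤q = subst (_≤ p * q) (ℚ.*-zeroʳ p)
    (ℚ.*-monoˡ-≤-nonNeg p {{nonNegative 0≤p}} 0≤q)

  0<* : ∀ {p q} → 0ℚ < p → 0ℚ < q → 0ℚ < p * q
  0<* {p} {q} 0<p 0<q = subst (_< p * q) (ℚ.*-zeroʳ p)
    (ℚ.*-monoʳ-<-pos p {{positive 0<p}} 0<q)

  0<1 : 0ℚ < 1ℚ
  0<1 = ℚ.positive⁻¹ 1ℚ

  0≤² : ∀ p → 0ℚ ≤ p * p
  0≤² p with ℚ.≤-total 0ℚ p
  ... | inj₁ 0≤p = 0≤* 0≤p 0≤p
  ... | inj₂ p≤0 = subst (0ℚ ≤_)
    (solve 1 (λ p → (con 0ℚ :- p) :* (con 0ℚ :- p) := p :* p) refl p)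
    (0≤* (0≤- p≤0) (0≤- p≤0))

  0<½* : ∀ {ε} → 0ℚ < ε → 0ℚ < ½ * ε
  0<½* = 0<* (ℚ.positive⁻¹ ½)

  ½*+½* : ∀ ε → ½ * ε + ½ * ε ≡ ε
  ½*+½* = solve 1 (λ e → con ½ :* e :+ con ½ :* e := e) refl

  ½*< : ∀ {ε} → 0ℚ < ε → ½ * ε < ε
  ½*< {ε} 0<ε = <-by (0<½* 0<ε) (½*+½* ε)

  abstract
    -- The quotient comes with its defining equation, so that the ring solver never meets a
    -- reciprocal.
    divide : ∀ {B ε} → 0ℚ < B → 0ℚ < ε → ∃[ δ ] 0ℚ < δ × B * δ ≡ ε
    divide {B} {ε} 0<B 0<ε = 1/B * ε , 0<* (ℚ.positive⁻¹ 1/B {{ℚ.1/pos⇒pos B}}) 0<ε ,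
      trans (sym (ℚ.*-assoc B 1/B ε)) (trans (cong (_* ε) (ℚ.*-inverseʳ B)) (ℚ.*-identityˡ ε))
      where
      instance
        B⁺ : Positive B
        B⁺ = positive 0<B
        B≢0 : NonZero B
        B≢0 = ℚ.pos⇒nonZero B
      1/B : ℚ
      1/B = 1/ B

  0<⊓ : ∀ {p q} → 0ℚ < p → 0ℚ < q → 0ℚ < p ⊓ q
  0<⊓ {p} {q} 0<p 0<q with ℚ.⊓-sel p q
  ... | inj₁ eq = subst (0ℚ <_) (sym eq) 0<p
  ... | inj₂ eq = subst (0ℚ <_) (sym eq) 0<q

  p≤∣p∣ : ∀ p → p ≤ ∣ p ∣
  p≤∣p∣ p with ℚ.≤-total 0ℚ p
  ... | inj₁ 0≤p = ℚ.≤-reflexive (sym (ℚ.0≤p⇒∣p∣≡p 0≤p))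
  ... | inj₂ p≤0 = ℚ.≤-trans p≤0 (ℚ.0≤∣p∣ p)

  ∣-∣-comm : ∀ p q → ∣ p - q ∣ ≡ ∣ q - p ∣
  ∣-∣-comm p q = trans (sym (ℚ.∣-p∣≡∣p∣ (p - q)))
    (cong ∣_∣ (solve 2 (λ p q → :- (p :- q) := q :- p) refl p q))

  ∣-∣≤⇒≤+ : ∀ {p q e} → ∣ p - q ∣ ≤ e → p ≤ q + e
  ∣-∣≤⇒≤+ {p} {q} {e} h = ≤-by (0≤- (ℚ.≤-trans (p≤∣p∣ (p - q)) h))
    (solve 3 (λ p q e → p :+ (e :- (p :- q)) := q :+ e) refl p q e)

  ∣-∣≤⇒≥+ : ∀ {p q e} → ∣ p - q ∣ ≤ e → q ≤ p + e
  ∣-∣≤⇒≥+ {p} {q} {e} h = ∣-∣≤⇒≤+ (subst (_≤ e) (∣-∣-comm p q) h)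

  ≤+⇒∣-∣≤ : ∀ {p q e} → p ≤ q + e → q ≤ p + e → ∣ p - q ∣ ≤ e
  ≤+⇒∣-∣≤ {p} {q} {e} p≤ q≤ with ℚ.∣p∣≡p∨∣p∣≡-p (p - q)
  ... | inj₁ eq = subst (_≤ e) (sym eq) (≤-by (0≤- p≤)
          (solve 3 (λ p q e → p :- q :+ (q :+ e :- p) := e) refl p q e))
  ... | inj₂ eq = subst (_≤ e) (sym eq) (≤-by (0≤- q≤)
          (solve 3 (λ p q e → :- (p :- q) :+ (p :+ e :- q) := e) refl p q e))

  ∣*∣≤ : ∀ {p q A B} → ∣ p ∣ ≤ A → ∣ q ∣ ≤ B → ∣ p * q ∣ ≤ A * B
  ∣*∣≤ {p} {q} {A} {B} p≤A q≤B = subst (_≤ A * B) (sym (ℚ.∣p*q∣≡∣p∣*∣q∣ p q))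
    (ℚ.≤-trans (ℚ.*-monoʳ-≤-nonNeg ∣ q ∣ {{ℚ.∣-∣-nonNeg q}} p≤A)
               (ℚ.*-monoˡ-≤-nonNeg A {{nonNegative (ℚ.≤-trans (ℚ.0≤∣p∣ p) p≤A)}} q≤B))

  -- Write p q - p′ q′ = p (q - q′) + q′ (p - p′); since δ ≤ 1, |q′| is at most A + 1.
  *-stable : ∀ {p p′ q q′ A δ} → δ ≤ 1ℚ → ∣ p ∣ ≤ A → ∣ q ∣ ≤ A →
    ∣ p - p′ ∣ ≤ δ → ∣ q - q′ ∣ ≤ δ → ∣ p * q - p′ * q′ ∣ ≤ (A + A + 1ℚ) * δ
  *-stable {p} {p′} {q} {q′} {A} {δ} δ≤1 p≤A q≤A p~ q~ = subst₂ (λ y z → ∣ y ∣ ≤ z)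
    (solve 4 (λ p p′ q q′ → p :* (q :- q′) :+ q′ :* (p :- p′) := p :* q :- p′ :* q′) refl p p′ q q′)
    (solve 2 (λ a d → a :* d :+ (a :+ con 1ℚ) :* d := (a :+ a :+ con 1ℚ) :* d) refl A δ)
    (ℚ.≤-trans (ℚ.∣p+q∣≤∣p∣+∣q∣ (p * (q - q′)) (q′ * (p - p′)))
       (ℚ.+-mono-≤ (∣*∣≤ p≤A q~) (∣*∣≤ q′≤ p~)))
    where
    q′≤ : ∣ q′ ∣ ≤ A + 1ℚ
    q′≤ = ℚ.≤-trans
      (subst (λ z → ∣ z ∣ ≤ ∣ q ∣ + ∣ q′ - q ∣) (solve 2 (λ q q′ → q :+ (q′ :- q) := q′) refl q q′)
        (ℚ.∣p+q∣≤∣p∣+∣q∣ q (q′ - q)))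
      (ℚ.+-mono-≤ q≤A (ℚ.≤-trans (ℚ.≤-reflexive (∣-∣-comm q′ q)) (ℚ.≤-trans q~ δ≤1)))

  -- v ≈ 1/√q.  Only the lower bound carries an error term, so that v = 1
  -- is an exact approximation for q = 1.
  record Rsqrt (δ q v : ℚ) : Set where
    constructor rsqrt
    field
      0≤v : 0ℚ ≤ v
      hi  : q * (v * v) ≤ 1ℚ
      lo  : 1ℚ ≤ q * (v * v) + δ

  -- Uniform continuity of 1/√ on [γ, ∞), robust under approximation errors. Values more than ε
  -- apart would give γ² ε² ≤ (γ + 1) δ; the choice (γ + 2) δ = γ² ε² leaves a spare δ that
  -- contradicts this.
  rsqrt-stable : ∀ {γ ε} → 0ℚ < γ → 0ℚ < ε → ∃[ δ ] 0ℚ < δ × (∀ {q q′ v v′} →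
    γ ≤ q → γ ≤ q′ → Rsqrt δ q v → Rsqrt δ q′ v′ → ∣ q - q′ ∣ ≤ δ → ∣ v - v′ ∣ ≤ ε)
  rsqrt-stable {γ} {ε} 0<γ 0<ε =
    let δ , 0<δ , eq = divide {γ + 1ℚ + 1ℚ} (0<+ (0<+ 0<γ (ℚ.<⇒≤ 0<1)) (ℚ.<⇒≤ 0<1))
                         (0<* (0<* 0<γ 0<γ) (0<* 0<ε 0<ε))
    in δ , 0<δ , λ {q} {q′} γ≤q γ≤q′ v v′ h →
      ≤+⇒∣-∣≤ (one-sided 0<δ eq γ≤q γ≤q′ v v′ (∣-∣≤⇒≥+ {q} {q′} h))
               (one-sided 0<δ eq γ≤q′ γ≤q v′ v (∣-∣≤⇒≤+ {q} {q′} h))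
    where
    one-sided : ∀ {δ q q′ v v′} → 0ℚ < δ → (γ + 1ℚ + 1ℚ) * δ ≡ γ * γ * (ε * ε) →
      γ ≤ q → γ ≤ q′ → Rsqrt δ q v → Rsqrt δ q′ v′ → q′ ≤ q + δ → v ≤ v′ + ε
    one-sided {δ} {q} {q′} {v} {v′} 0<δ eq γ≤q γ≤q′ (rsqrt 0≤v hi _) (rsqrt 0≤v′ hi′ lo′) q′≤q+δ
      with v ℚ.≤? v′ + ε
    ... | yes v≤ = v≤
    ... | no v≰ = contradiction (ℚ.≤-<-trans bound (<-by 0<δ
            (trans (solve 2 (λ γ δ → (γ :+ con 1ℚ) :* δ :+ δ := (γ :+ con 1ℚ :+ con 1ℚ) :* δ) refl γ δ) eq)))
            (ℚ.<-irrefl refl)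
      where
      v′+ε≤v = ℚ.<⇒≤ (ℚ.≰⇒> v≰)
      0≤γ = ℚ.<⇒≤ 0<γ
      0≤ε = ℚ.<⇒≤ 0<ε
      0≤δ = ℚ.<⇒≤ 0<δ
      0≤q = ℚ.≤-trans 0≤γ γ≤q
      v²-gap : 0ℚ ≤ v * v - v′ * v′ - ε * ε
      v²-gap = subst (0ℚ ≤_)
        (solve 3 (λ v v′ ε → (v :- (v′ :+ ε)) :* (v :+ (v′ :+ ε)) :+ (v′ :* ε :+ v′ :* ε)
                           := v :* v :- v′ :* v′ :- ε :* ε) refl v v′ ε)
        (0≤+ (0≤* (0≤- v′+ε≤v) (0≤+ 0≤v (0≤+ 0≤v′ 0≤ε))) (0≤+ (0≤* 0≤v′ 0≤ε) (0≤* 0≤v′ 0≤ε)))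
      -- If v > v′ + ε then 1 ≥ q v² ≥ q v′² + q ε² ≥ 1 − δ − δ v′² + γ ε², while γ v′² ≤ 1.
      bound : γ * γ * (ε * ε) ≤ (γ + 1ℚ) * δ
      bound = ≤-by
        (0≤+ (0≤* 0≤γ (0≤+ (0≤+ (0≤+ (0≤+ (0≤- hi) (0≤* 0≤q v²-gap)) (0≤* (0≤- γ≤q) (0≤² ε)))
                                (0≤* (0≤- q′≤q+δ) (0≤² v′))) (0≤- lo′)))
             (0≤* 0≤δ (0≤+ (0≤- hi′) (0≤* (0≤- γ≤q′) (0≤² v′)))))
        (solve 7 (λ γ ε δ q q′ v v′ →
            γ :* γ :* (ε :* ε)
            :+ (γ :* ((con 1ℚ :- q :* (v :* v)) :+ q :* (v :* v :- v′ :* v′ :- ε :* ε)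
                       :+ (q :- γ) :* (ε :* ε) :+ (q :+ δ :- q′) :* (v′ :* v′)
                       :+ (q′ :* (v′ :* v′) :+ δ :- con 1ℚ))
                :+ δ :* ((con 1ℚ :- q′ :* (v′ :* v′)) :+ (q′ :- γ) :* (v′ :* v′)))
            := (γ :+ con 1ℚ) :* δ) refl γ ε δ q q′ v v′)

  fromℕ : ℕ → ℚ
  fromℕ n = mkℚ (+ n) 0 (Coprime.sym (Coprime.1-coprimeTo n))

  fromℕ-suc : ∀ n → 1ℚ + fromℕ n ≡ fromℕ (suc n)
  fromℕ-suc n = ℚ.toℚᵘ-injective (ℚᵘ.≃-trans (ℚ.toℚᵘ-homo-+ 1ℚ (fromℕ n))
    (ℚᵘ.*≡* (solveℤ 1 (λ n → (conℤ (+ 1) ⊠ conℤ (+ 1) ⊞ n ⊠ conℤ (+ 1)) ⊠ conℤ (+ 1)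
      ≣ (conℤ (+ 1) ⊞ n) ⊠ conℤ (+ 1)) refl (+ n))))
    where
    open ℤ-Solver.+-*-Solver
      using () renaming (solve to solveℤ; con to conℤ; _:+_ to _⊞_; _:*_ to _⊠_; _:=_ to _≣_)

  abstract
    -- The denominator is at least 1, so the absolute value of the numerator is a bound.
    archimedean : ∀ q → ∃[ n ] q ≤ fromℕ n
    archimedean q@record{} = ℤ.∣ ↥ q ∣ , *≤* (ℤ.≤-trans
      (ℤ.≤-reflexive (ℤ.*-identityʳ (↥ q)))
      (ℤ.≤-trans (i≤∣i∣ (↥ q)) (ℤ.≤-trans (ℤ.≤-reflexive (sym (ℤ.*-identityʳ (+ ℤ.∣ ↥ q ∣))))
         (ℤ.*-monoˡ-≤-nonNeg (+ ℤ.∣ ↥ q ∣) (ℤ.+≤+ (ℕ.s≤s ℕ.z≤n))))))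
      where
      i≤∣i∣ : ∀ i → i ℤ.≤ + ℤ.∣ i ∣
      i≤∣i∣ (+ n) = ℤ.≤-refl
      i≤∣i∣ -[1+ n ] = ℤ.-≤+

  1/suc : ℕ → ℚ
  1/suc n = mkℚ (+ 1) n (Coprime.1-coprimeTo (suc n))

  0<1/suc : ∀ n → 0ℚ < 1/suc n
  0<1/suc n = ℚ.positive⁻¹ (1/suc n)

  -- A positive ε with denominator d + 1 is at least 1/(d + 1), so k = d works.
  1/suc→0 : ∀ {ε} → 0ℚ < ε → ∃[ k ] ∀ n → k ℕ.≤ n → 1/suc n ≤ ε
  1/suc→0 {mkℚ (+ zero) d c} (*<* (ℤ.+<+ ()))
  1/suc→0 {mkℚ -[1+ a ] d c} (*<* ())
  1/suc→0 {mkℚ +[1+ a ] d c} _ = d , λ n d≤n → *≤* (ℤ.+≤+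
    (ℕ.*-mono-≤ {1} {suc a} (ℕ.s≤s ℕ.z≤n) (ℕ.s≤s d≤n)))

  -- Search for the last point of a grid of mesh h on which q v² ≤ 1.
  abstract
    rsqrt-search : ∀ {q h} n {v} → 0ℚ ≤ h → 0ℚ ≤ v → q * (v * v) ≤ 1ℚ →
      let w = v + fromℕ n * h in 1ℚ < q * (w * w) →
      ∃[ v ] 0ℚ ≤ v × q * (v * v) ≤ 1ℚ × 1ℚ ≤ q * ((v + h) * (v + h))
    rsqrt-search {q} {h} zero {v} _ _ hi w = contradiction
      (ℚ.<-≤-trans (subst (λ w → 1ℚ < q * (w * w)) (solve 2 (λ v h → v :+ con 0ℚ :* h := v) refl v h) w) hi)
      (ℚ.<-irrefl refl)
    rsqrt-search {q} {h} (suc n) {v} 0≤h 0≤v hi w with q * ((v + h) * (v + h)) ℚ.≤? 1ℚ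
    ... | no ≰1 = v , 0≤v , hi , ℚ.<⇒≤ (ℚ.≰⇒> ≰1)
    ... | yes ≤1 = rsqrt-search {q} n 0≤h (0≤+ 0≤v 0≤h) ≤1
      (subst (λ w → 1ℚ < q * (w * w))
        (trans (cong (λ m → v + m * h) (sym (fromℕ-suc n)))
          (solve 3 (λ v h m → v :+ (con 1ℚ :+ m) :* h := v :+ h :+ m :* h) refl v h (fromℕ n))) w)

  -- Provides the far end of the search grid: for w ≥ 1 + 1/q both w and q w exceed 1.
  1<q*w² : ∀ {q q⁻¹ w} → 0ℚ < q → 0ℚ < q⁻¹ → q * q⁻¹ ≡ 1ℚ → 1ℚ + q⁻¹ ≤ w → 1ℚ < q * (w * w)
  1<q*w² {q} {q⁻¹} {w} 0<q 0<q⁻¹ q*q⁻¹≡1 w≥ = <-by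
    (0<+ (0<+ (0<+ (0<* 0<q 0<w) (ℚ.<⇒≤ 0<q⁻¹)) (0≤- w≥)) (0≤* (ℚ.<⇒≤ (0<* 0<q 0<w)) (0≤- w≥)))
    (trans (solve 3 (λ q i w →
        con 1ℚ :+ (q :* w :+ i :+ (w :- (con 1ℚ :+ i)) :+ q :* w :* (w :- (con 1ℚ :+ i)))
        := q :* (w :* w) :+ (w :- w :* (q :* i))) refl q q⁻¹ w)
      (trans (cong (λ z → q * (w * w) + (w - w * z)) q*q⁻¹≡1)
        (solve 2 (λ q w → q :* (w :* w) :+ (w :- w :* con 1ℚ) := q :* (w :* w)) refl q w)))
    where
    0<w : 0ℚ < w
    0<w = ℚ.<-≤-trans (0<+ 0<1 (ℚ.<⇒≤ 0<q⁻¹)) w≥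

  -- Replacing v + h by v costs q (2 v h + h²). As 2 v ≤ 1 + v², q v² ≤ 1 and h ≤ 1, this is at most
  -- (2 q + 1) h ≤ δ.
  rsqrt-refine : ∀ {q δ d h v} → 0ℚ ≤ q → 0ℚ ≤ h → h ≤ d → h ≤ 1ℚ → (q + q + 1ℚ) * d ≡ δ →
    0ℚ ≤ v → q * (v * v) ≤ 1ℚ → 1ℚ ≤ q * ((v + h) * (v + h)) → Rsqrt δ q v
  rsqrt-refine {q} {δ} {d} {h} {v} 0≤q 0≤h h≤d h≤1 B*d≡δ 0≤v hi lo = rsqrt 0≤v hi (≤-by
    (0≤+ (0≤+ (0≤- lo) (0≤* (0≤+ (0≤+ 0≤q 0≤q) (ℚ.<⇒≤ 0<1)) (0≤- h≤d)))
         (0≤* 0≤h (0≤+ (0≤+ (0≤* 0≤q (0≤² (1ℚ - v))) (0≤- hi)) (0≤* 0≤q (0≤- h≤1)))))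
    (trans (solve 4 (λ q d h v →
        con 1ℚ :+ ((q :* ((v :+ h) :* (v :+ h)) :- con 1ℚ) :+ (q :+ q :+ con 1ℚ) :* (d :- h)
          :+ h :* (q :* ((con 1ℚ :- v) :* (con 1ℚ :- v)) :+ (con 1ℚ :- q :* (v :* v)) :+ q :* (con 1ℚ :- h)))
        := q :* (v :* v) :+ (q :+ q :+ con 1ℚ) :* d) refl q d h v)
      (cong (λ z → q * (v * v) + z) B*d≡δ)))

  ≤-grid : ∀ {a h m} n → 0ℚ ≤ h → h * m ≡ a → m ≤ fromℕ n → a ≤ 0ℚ + fromℕ n * h
  ≤-grid {a} {h} {m} n 0≤h h*m≡a m≤n = ≤-by (0≤* 0≤h (0≤- m≤n))
    (trans (cong (_+ h * (fromℕ n - m)) (sym h*m≡a))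
      (solve 3 (λ h m n → h :* m :+ h :* (n :- m) := con 0ℚ :+ n :* h) refl h m (fromℕ n)))

  rsqrt-approx : ∀ {q δ} → 0ℚ < q → 0ℚ < δ → ∃[ v ] Rsqrt δ q v
  rsqrt-approx {q} {δ} 0<q 0<δ =
    let d , 0<d , B*d≡δ       = divide {q + q + 1ℚ} (0<+ (0<+ 0<q 0≤q) (ℚ.<⇒≤ 0<1)) 0<δ
        q⁻¹ , 0<q⁻¹ , q*q⁻¹≡1 = divide 0<q 0<1
        0<h                   = 0<⊓ 0<d 0<1
        -- Here h m = 1 + 1/q, so n ≥ m steps of mesh h lead from 0 beyond 1/√q.
        m , _ , h*m≡          = divide 0<h (0<+ 0<1 (ℚ.<⇒≤ 0<q⁻¹))
        n , m≤n               = archimedean m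
        v , 0≤v , hi , lo     = rsqrt-search {q} {d ⊓ 1ℚ} n {0ℚ} (ℚ.<⇒≤ 0<h) ℚ.≤-refl q*0≤1
          (1<q*w² {q} {q⁻¹} 0<q 0<q⁻¹ q*q⁻¹≡1 (≤-grid n (ℚ.<⇒≤ 0<h) h*m≡ m≤n))
    in v , rsqrt-refine 0≤q (ℚ.<⇒≤ 0<h) (ℚ.p⊓q≤p d 1ℚ) (ℚ.p⊓q≤q d 1ℚ) B*d≡δ 0≤v hi lo
    where
    0≤q = ℚ.<⇒≤ 0<q
    q*0≤1 : q * (0ℚ * 0ℚ) ≤ 1ℚ
    q*0≤1 = ≤-by (ℚ.<⇒≤ 0<1) (solve 1 (λ q → q :* (con 0ℚ :* con 0ℚ) :+ con 1ℚ := con 1ℚ) refl q)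

  rsqrt-weaken : ∀ {δ ε q v} → δ ≤ ε → Rsqrt δ q v → Rsqrt ε q v
  rsqrt-weaken {q = q} {v} δ≤ε (rsqrt 0≤v hi lo) =
    rsqrt 0≤v hi (ℚ.≤-trans lo (ℚ.+-monoʳ-≤ (q * (v * v)) δ≤ε))

open Rationals

open import Defs
open import Algebra.Properties.CommutativeMonoid.Sum +-0-commutativeMonoid
  using (sum-cong-≋; sum-replicate-zero; ∑-distrib-+; ∑-comm)

-- Closeness of reals

pointwise : ∀ {x y} → (∀ n → seq x n ≡ seq y n) → x ≈ y
pointwise {x} {y} eq = mk≈ λ ε 0<ε → 0 , λ n _ → subst (λ z → ℚ.∣ z ∣ ℚ.< ε)
  (sym (trans (cong (ℚ._- seq y n) (eq n)) (ℚ.+-inverseʳ (seq y n)))) 0<ε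

-- A rational, non-strict error bound: errors can be added, halved and compared in ℚ, without the
-- gap that `_<_` on reals carries.
record Close (ε : ℚ) (x y : ℝ) : Set where
  constructor mkClose
  field
    from  : ℕ
    bound : ∀ n → from ℕ.≤ n → ℚ.∣ seq x n ℚ.- seq y n ∣ ℚ.≤ ε

module _ {j k n : ℕ} (j⊔k≤n : j ℕ.⊔ k ℕ.≤ n) where
  ⊔≤ˡ : j ℕ.≤ n
  ⊔≤ˡ = ℕ.m⊔n≤o⇒m≤o j k j⊔k≤n
  ⊔≤ʳ : k ℕ.≤ n
  ⊔≤ʳ = ℕ.m⊔n≤o⇒n≤o j k j⊔k≤n

≈⇒Close : ∀ {x y ε} → 0ℚ ℚ.< ε → x ≈ y → Close ε x y
≈⇒Close 0<ε (mk≈ h) = let k , p = h _ 0<ε in mkClose k λ n k≤n → ℚ.<⇒≤ (p n k≤n)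

Close⇒≈ : ∀ {x y} → (∀ {ε} → 0ℚ ℚ.< ε → Close ε x y) → x ≈ y
Close⇒≈ h = mk≈ λ ε 0<ε → let mkClose k p = h (0<½* 0<ε) in
  k , λ n k≤n → ℚ.≤-<-trans (p n k≤n) (½*< 0<ε)

Close-sym : ∀ {x y ε} → Close ε x y → Close ε y x
Close-sym {x} {y} (mkClose k p) = mkClose k λ n k≤n →
  ℚ.≤-trans (ℚ.≤-reflexive (∣-∣-comm (seq y n) (seq x n))) (p n k≤n)

Close-mono : ∀ {x y δ ε} → δ ℚ.≤ ε → Close δ x y → Close ε x y
Close-mono δ≤ε (mkClose k p) = mkClose k λ n k≤n → ℚ.≤-trans (p n k≤n) δ≤ε

+-Close : ∀ {x x′ y y′ δ ε} → Close δ x x′ → Close ε y y′ → Close (δ ℚ.+ ε) (x + y) (x′ + y′)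
+-Close {x} {x′} {y} {y′} {δ} {ε} (mkClose j p) (mkClose k q) = mkClose (j ℕ.⊔ k) λ n n≥ →
  subst (λ z → ℚ.∣ z ∣ ℚ.≤ δ ℚ.+ ε)
    (solve 4 (λ x x′ y y′ → (x :- x′) :+ (y :- y′) := (x :+ y) :- (x′ :+ y′)) refl
      (seq x n) (seq x′ n) (seq y n) (seq y′ n))
    (ℚ.≤-trans (ℚ.∣p+q∣≤∣p∣+∣q∣ (seq x n ℚ.- seq x′ n) (seq y n ℚ.- seq y′ n))
      (ℚ.+-mono-≤ (p n (⊔≤ˡ n≥)) (q n (⊔≤ʳ n≥))))

neg-Close : ∀ {x y ε} → Close ε x y → Close ε (- x) (- y)
neg-Close {x} {y} {ε} (mkClose k p) = mkClose k λ n k≤n →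
  subst (λ z → ℚ.∣ z ∣ ℚ.≤ ε)
    (solve 2 (λ x y → y :- x := (:- x) :- (:- y)) refl (seq x n) (seq y n))
    (ℚ.≤-trans (ℚ.≤-reflexive (∣-∣-comm (seq y n) (seq x n))) (p n k≤n))

eventuallyBounded : ∀ x → ∃[ A ] 0ℚ ℚ.≤ A × ∃[ k ] ∀ n → k ℕ.≤ n → ℚ.∣ seq x n ∣ ℚ.≤ A
eventuallyBounded x = let k , p = cauchy x 1ℚ 0<1 in
  1ℚ ℚ.+ ℚ.∣ seq x k ∣ , 0≤+ (ℚ.<⇒≤ 0<1) (ℚ.0≤∣p∣ (seq x k)) , k , λ n k≤n →
    ℚ.≤-trans
      (subst (λ z → ℚ.∣ z ∣ ℚ.≤ ℚ.∣ seq x n ℚ.- seq x k ∣ ℚ.+ ℚ.∣ seq x k ∣)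
        (solve 2 (λ a b → (a :- b) :+ b := a) refl (seq x n) (seq x k))
        (ℚ.∣p+q∣≤∣p∣+∣q∣ (seq x n ℚ.- seq x k) (seq x k)))
      (ℚ.+-monoˡ-≤ ℚ.∣ seq x k ∣ (ℚ.<⇒≤ (p n k k≤n ℕ.≤-refl)))

-- The bound `C` depends on `x` and `y` only, so one `δ` serves all `x′` and `y′`. Both congruence
-- and continuity of the product follow from this.
*-Close : ∀ x y {ε} → 0ℚ ℚ.< ε → ∃[ δ ] 0ℚ ℚ.< δ × (∀ {x′ y′} →
  Close δ x x′ → Close δ y y′ → Close ε (x * y) (x′ * y′))
*-Close x y {ε} 0<ε =
  let A , 0≤A , a , x≤A = eventuallyBounded x
      B , 0≤B , b , y≤B = eventuallyBounded y
      C                 = A ℚ.+ B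
      0≤C               = 0≤+ 0≤A 0≤B
      A≤C               = ≤-by 0≤B refl
      B≤C               = ≤-by 0≤A (ℚ.+-comm B A)
      η , 0<η , eq      = divide {C ℚ.+ C ℚ.+ 1ℚ}
                            (ℚ.+-mono-≤-< (0≤+ 0≤C 0≤C) 0<1) 0<ε
  in η ℚ.⊓ 1ℚ , 0<⊓ 0<η 0<1 , λ { {x′} {y′} (mkClose j p) (mkClose k q) →
    mkClose ((a ℕ.⊔ b) ℕ.⊔ (j ℕ.⊔ k)) λ n n≥ → ℚ.≤-trans
      (*-stable (ℚ.p⊓q≤q η 1ℚ)
        (ℚ.≤-trans (x≤A n (⊔≤ˡ {a} {b} (⊔≤ˡ n≥))) A≤C) (ℚ.≤-trans (y≤B n (⊔≤ʳ {a} {b} (⊔≤ˡ n≥))) B≤C)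
        (p n (⊔≤ˡ {j} {k} (⊔≤ʳ {a ℕ.⊔ b} n≥))) (q n (⊔≤ʳ {j} {k} (⊔≤ʳ {a ℕ.⊔ b} n≥))))
      (ℚ.≤-trans
        (ℚ.*-monoˡ-≤-nonNeg (C ℚ.+ C ℚ.+ 1ℚ) {{ℚ.nonNegative (0≤+ (0≤+ 0≤C 0≤C) (ℚ.<⇒≤ 0<1))}}
          (ℚ.p⊓q≤p η 1ℚ))
        (ℚ.≤-reflexive eq)) }

neg-cong : ∀ {x y} → x ≈ y → - x ≈ - y
neg-cong x≈y = Close⇒≈ λ 0<ε → neg-Close (≈⇒Close 0<ε x≈y)

minus-cong : ∀ {x y u v} → x ≈ y → u ≈ v → x - u ≈ y - v
minus-cong x≈y u≈v = +-cong x≈y (neg-cong u≈v)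

*-cong : ∀ {x y u v} → x ≈ y → u ≈ v → x * u ≈ y * v
*-cong {x} {y} {u} {v} x≈y u≈v = Close⇒≈ λ 0<ε →
  let δ , 0<δ , close = *-Close x u 0<ε in close (≈⇒Close 0<δ x≈y) (≈⇒Close 0<δ u≈v)

-- Order

from-gap : ∀ {x} g → 0ℚ ℚ.< g → ∀ k → (∀ n → k ℕ.≤ n → g ℚ.≤ seq x n) → 0ℝ < x
from-gap {x} g 0<g k p = mk< g 0<g k λ n k≤n →
  subst (ℚ._≤ seq x n) (sym (ℚ.+-identityˡ g)) (p n k≤n)

to-gap : ∀ {x} → 0ℝ < x → ∃[ g ] 0ℚ ℚ.< g × ∃[ k ] ∀ n → k ℕ.≤ n → g ℚ.≤ seq x n
to-gap {x} (mk< g 0<g k p) = g , 0<g , k , λ n k≤n →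
  subst (ℚ._≤ seq x n) (ℚ.+-identityˡ g) (p n k≤n)

<⇒0<- : ∀ {x y} → x < y → 0ℝ < y - x
<⇒0<- {x} {y} (mk< g 0<g k p) = from-gap g 0<g k λ n k≤n →
  ≤-by (0≤- (p n k≤n)) (solve 3 (λ g x y → g :+ (y :- (x :+ g)) := y :- x) refl g (seq x n) (seq y n))

0<-⇒< : ∀ {x y} → 0ℝ < y - x → x < y
0<-⇒< {x} {y} h = let g , 0<g , k , p = to-gap h in mk< g 0<g k λ n k≤n →
  ≤-by (0≤- (p n k≤n)) (solve 3 (λ g x y → (x :+ g) :+ ((y :- x) :- g) := y) refl g (seq x n) (seq y n))

0<-resp-≈ : ∀ {x y} → x ≈ y → 0ℝ < x → 0ℝ < y
0<-resp-≈ {x} {y} x≈y 0<x =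
  let g , 0<g , j , p = to-gap 0<x
      mkClose k q = ≈⇒Close (0<½* 0<g) x≈y
  in from-gap (½ ℚ.* g) (0<½* 0<g) (j ℕ.⊔ k) λ n n≥ →
    ≤-by (0≤+ (0≤- (p n (⊔≤ˡ n≥))) (0≤- (∣-∣≤⇒≤+ {seq x n} {seq y n} (q n (⊔≤ʳ n≥)))))
      (solve 3 (λ g x y → con ½ :* g :+ ((x :- g) :+ (y :+ con ½ :* g :- x)) := y) refl g (seq x n) (seq y n))

¬0<0 : ¬ (0ℝ < 0ℝ)
¬0<0 h = let g , 0<g , k , p = to-gap h in ℚ.<-irrefl refl (ℚ.<-≤-trans 0<g (p k ℕ.≤-refl))

-- If x is near x_k and x_k ≥ ½ g then x ≥ ¼ g; otherwise x ≤ ¾ g.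
0<+⇒ : ∀ {x y} → 0ℝ < x + y → 0ℝ < x ⊎ 0ℝ < y
0<+⇒ {x} {y} h with to-gap h
... | g , 0<g , j , p with cauchy x (½ ℚ.* (½ ℚ.* g)) (0<½* (0<½* 0<g))
... | k , q with ½ ℚ.* g ℚ.≤? seq x k
... | yes ≥ = inj₁ (from-gap (½ ℚ.* (½ ℚ.* g)) (0<½* (0<½* 0<g)) k λ n k≤n →
  ≤-by (0≤+ (0≤- ≥) (0≤- (∣-∣≤⇒≥+ {seq x n} {seq x k} (ℚ.<⇒≤ (q n k k≤n ℕ.≤-refl)))))
    (solve 3 (λ g x x′ → con ½ :* (con ½ :* g) :+ ((x′ :- con ½ :* g) :+ (x :+ con ½ :* (con ½ :* g) :- x′)) := x)
      refl g (seq x n) (seq x k)))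
... | no ≱ = inj₂ (from-gap (½ ℚ.* (½ ℚ.* g)) (0<½* (0<½* 0<g)) (j ℕ.⊔ k) λ n n≥ →
  ≤-by (0≤+ (0≤+ (0≤- (p n (⊔≤ˡ n≥))) (0≤- (ℚ.<⇒≤ (ℚ.≰⇒> ≱))))
        (0≤- (∣-∣≤⇒≤+ {seq x n} {seq x k} (ℚ.<⇒≤ (q n k (⊔≤ʳ n≥) ℕ.≤-refl)))))
    (solve 4 (λ g x x′ y → con ½ :* (con ½ :* g)
        :+ (((x :+ y) :- g) :+ (con ½ :* g :- x′) :+ (x′ :+ con ½ :* (con ½ :* g) :- x)) := y)
      refl g (seq x n) (seq x k) (seq y n)))

*-pos : ∀ {x y} → 0ℝ < x → 0ℝ < y → 0ℝ < x * y
*-pos {x} {y} 0<x 0<y =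
  let g , 0<g , j , p = to-gap 0<x
      h , 0<h , k , q = to-gap 0<y
  in from-gap (g ℚ.* h) (0<* 0<g 0<h) (j ℕ.⊔ k) λ n n≥ →
    ≤-by (0≤+ (0≤* (ℚ.<⇒≤ 0<g) (0≤- (q n (⊔≤ʳ n≥))))
              (0≤* (ℚ.≤-trans (ℚ.<⇒≤ 0<h) (q n (⊔≤ʳ n≥))) (0≤- (p n (⊔≤ˡ n≥)))))
      (solve 4 (λ g h x y → g :* h :+ (g :* (y :- h) :+ y :* (x :- g)) := x :* y) refl g h (seq x n) (seq y n))

0<-⇒<0 : ∀ {x} → 0ℝ < - x → x < 0ℝ
0<-⇒<0 {x} h = 0<-⇒< (0<-resp-≈ (pointwise λ n → sym (ℚ.+-identityˡ (ℚ.- seq x n))) h)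

0<1ℝ : 0ℝ < 1ℝ
0<1ℝ = from-gap 1ℚ 0<1 0 λ _ _ → ℚ.≤-refl

<0⇒0<- : ∀ {x} → x < 0ℝ → 0ℝ < - x
<0⇒0<- {x} x<0 = 0<-resp-≈ (pointwise λ n → ℚ.+-identityˡ (ℚ.- seq x n)) (<⇒0<- x<0)

-- Since `0ℝ ≤ y` is a mere negation, no gap can be read off from it. Instead x = (x + y) - y is
-- split by `0<+⇒`, and `0ℝ < - y` is excluded.
+-pos-nonNeg : ∀ {x y} → 0ℝ < x → 0ℝ ≤ y → 0ℝ < x + y
+-pos-nonNeg {x} {y} 0<x 0≤y = [ id , (λ 0<-y → contradiction (0<-⇒<0 0<-y) 0≤y) ]′
  (0<+⇒ (0<-resp-≈ (pointwise λ n →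
    solve 2 (λ x y → x := (x :+ y) :- y) refl (seq x n) (seq y n)) 0<x))

+-nonNeg-pos : ∀ {x y} → 0ℝ ≤ x → 0ℝ < y → 0ℝ < x + y
+-nonNeg-pos {x} {y} 0≤x 0<y =
  0<-resp-≈ (pointwise λ n → ℚ.+-comm (seq y n) (seq x n)) (+-pos-nonNeg 0<y 0≤x)

+-nonNeg : ∀ {x y} → 0ℝ ≤ x → 0ℝ ≤ y → 0ℝ ≤ x + y
+-nonNeg {x} {y} 0≤x 0≤y x+y<0 = [ 0≤x ∘ 0<-⇒<0 , 0≤y ∘ 0<-⇒<0 ]′
  (0<+⇒ (0<-resp-≈ (pointwise λ n →
    solve 2 (λ x y → :- (x :+ y) := (:- x) :- y) refl (seq x n) (seq y n)) (<0⇒0<- x+y<0)))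

<⇒0≤ : ∀ {x} → 0ℝ < x → 0ℝ ≤ x
<⇒0≤ 0<x (mk< h 0<h k q) =
  let g , 0<g , j , p = to-gap 0<x
  in ℚ.<-irrefl refl (ℚ.<-≤-trans (0<+ 0<g (ℚ.<⇒≤ 0<h))
       (ℚ.≤-trans (ℚ.+-monoˡ-≤ h (p (j ℕ.⊔ k) (ℕ.m≤m⊔n j k))) (q (j ℕ.⊔ k) (ℕ.m≤n⊔m j k))))

-- A single late index refutes negativity: there x² y is nonnegative and at most -g.
²*-nonNeg : ∀ x {y} → 0ℝ < y → 0ℝ ≤ x * x * y
²*-nonNeg x {y} 0<y (mk< g 0<g j p) =
  let h , 0<h , k , q = to-gap 0<y
      n = j ℕ.⊔ k
  in ℚ.<-irrefl refl (ℚ.<-≤-trans 0<g (ℚ.≤-trans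
       (≤-by (0≤* (0≤² (seq x n)) (ℚ.≤-trans (ℚ.<⇒≤ 0<h) (q n (⊔≤ʳ {j} {k} ℕ.≤-refl))))
         (ℚ.+-comm g _))
       (p n (⊔≤ˡ {j} {k} ℕ.≤-refl))))

²-nonNeg : ∀ x → 0ℝ ≤ x * x
²-nonNeg x (mk< g 0<g k p) = ℚ.<-irrefl refl (ℚ.<-≤-trans 0<g (ℚ.≤-trans
  (≤-by (0≤² (seq x k)) (ℚ.+-comm g _)) (p k ℕ.≤-refl)))

*-#0 : ∀ {x y} → x # 0ℝ → 0ℝ < y → x * y # 0ℝ
*-#0 {x} {y} (inj₁ x<0) 0<y = inj₁ (0<-⇒<0 (0<-resp-≈
  (pointwise λ n → sym (ℚ.neg-distribˡ-* (seq x n) (seq y n))) (*-pos (<0⇒0<- x<0) 0<y)))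
*-#0 (inj₂ 0<x) 0<y = inj₂ (*-pos 0<x 0<y)

#0⇒0<² : ∀ {x} → x # 0ℝ → 0ℝ < x * x
#0⇒0<² {x} (inj₁ x<0) = 0<-resp-≈ (pointwise λ n →
  solve 1 (λ x → (:- x) :* (:- x) := x :* x) refl (seq x n)) (*-pos (<0⇒0<- x<0) (<0⇒0<- x<0))
#0⇒0<² (inj₂ 0<x) = *-pos 0<x 0<x

-- Outside of the two cases, |x| < η for an η ≤ 1 below the gap of x², so x² < η² ≤ η.
0<²⇒#0 : ∀ {x} → 0ℝ < x * x → x # 0ℝ
0<²⇒#0 {x} 0<x² =
  let g , 0<g , k , p = to-gap 0<x²
      η               = g ℚ.⊓ 1ℚ
      0<η             = 0<⊓ 0<g 0<1
      0<fromℚη        = from-gap {fromℚ η} η 0<η 0 λ _ _ → ℚ.≤-refl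
  in cases 0<η (ℚ.p⊓q≤p g 1ℚ) (ℚ.p⊓q≤q g 1ℚ) k p
       (0<+⇒ (0<-resp-≈ (pointwise λ n → solve 2 (λ e x → e := x :+ (e :- x)) refl η (seq x n)) 0<fromℚη))
       (0<+⇒ (0<-resp-≈ (pointwise λ n → solve 2 (λ e x → e := (:- x) :+ (e :+ x)) refl η (seq x n)) 0<fromℚη))
  where
  cases : ∀ {g η} → 0ℚ ℚ.< η → η ℚ.≤ g → η ℚ.≤ 1ℚ →
    ∀ k → (∀ n → k ℕ.≤ n → g ℚ.≤ seq x n ℚ.* seq x n) →
    0ℝ < x ⊎ 0ℝ < fromℚ η - x → 0ℝ < - x ⊎ 0ℝ < fromℚ η + x → x # 0ℝ
  cases _ _ _ _ _ (inj₁ 0<x) _ = inj₂ 0<x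
  cases _ _ _ _ _ (inj₂ _) (inj₁ 0<-x) = inj₁ (0<-⇒<0 0<-x)
  cases {g} {η} 0<η η≤g η≤1 k p (inj₂ x<η) (inj₂ -x<η) =
    let h , 0<h , l , q = to-gap (*-pos x<η -x<η)
        n = k ℕ.⊔ l
        y = seq x n
    in contradiction (ℚ.<-≤-trans 0<h (≤-by
         (0≤+ (0≤+ (0≤+ (0≤- (q n (⊔≤ʳ {k} {l} ℕ.≤-refl))) (0≤- (p n (⊔≤ˡ {k} {l} ℕ.≤-refl))))
                   (0≤- η≤g))
              (0≤* (ℚ.<⇒≤ 0<η) (0≤- η≤1)))
         (solve 4 (λ h g e y →
             h :+ (((e :- y) :* (e :+ y) :- h) :+ (y :* y :- g) :+ (g :- e) :+ e :* (con 1ℚ :- e)) := con 0ℚ)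
           refl h g η y)))
       (ℚ.<-irrefl refl)

-- Sums

sum-cong : ∀ {n} (f g : Fin n → ℝ) → (∀ i → f i ≈ g i) → sum f ≈ sum g
sum-cong f g = sum-cong-≋

sum-neg : ∀ {n} (f : Fin n → ℝ) → sum (λ i → - f i) ≈ - sum f
sum-neg {zero}  f = pointwise λ _ → refl
sum-neg {suc n} f = ≈-trans (+-cong ≈-refl (sum-neg (f ∘ suc)))
  (pointwise λ n → sym (ℚ.neg-distrib-+ (seq (f zero) n) _))

sum-minus : ∀ {n} (f g : Fin n → ℝ) → sum (λ i → f i - g i) ≈ sum f - sum g
sum-minus f g = ≈-trans (∑-distrib-+ f (λ i → - g i)) (+-cong ≈-refl (sum-neg g))

sum-*ʳ : ∀ {n} (f : Fin n → ℝ) x → sum (λ i → f i * x) ≈ sum f * x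
sum-*ʳ {zero}  f x = pointwise λ n → sym (ℚ.*-zeroˡ (seq x n))
sum-*ʳ {suc n} f x = ≈-trans (+-cong ≈-refl (sum-*ʳ (f ∘ suc) x))
  (pointwise λ n → sym (ℚ.*-distribʳ-+ (seq x n) (seq (f zero) n) _))

sum-nonNeg : ∀ {n} {f : Fin n → ℝ} → (∀ i → 0ℝ ≤ f i) → 0ℝ ≤ sum f
sum-nonNeg {zero}  0≤f = ¬0<0
sum-nonNeg {suc n} 0≤f = +-nonNeg (0≤f zero) (sum-nonNeg (0≤f ∘ suc))

sum-pos : ∀ {n} {f : Fin n → ℝ} → (∀ i → 0ℝ ≤ f i) → ∀ i → 0ℝ < f i → 0ℝ < sum f
sum-pos {suc n} 0≤f zero    0<fi = +-pos-nonNeg 0<fi (sum-nonNeg (0≤f ∘ suc))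
sum-pos {suc n} 0≤f (suc i) 0<fi = +-nonNeg-pos (0≤f zero) (sum-pos (0≤f ∘ suc) i 0<fi)

-- Each summand is split off by `0<+⇒`. This extracts an actual index from a total, such as
-- barycentric weights or squared coordinates adding up to 1.
0<sum⇒ : ∀ {n} (f : Fin n → ℝ) → 0ℝ < sum f → ∃[ i ] 0ℝ < f i
0<sum⇒ {zero} f h = contradiction h ¬0<0
0<sum⇒ {suc n} f h = [ (zero ,_) , (λ 0<s → let i , 0<fi = 0<sum⇒ (f ∘ suc) 0<s in suc i , 0<fi) ]′ (0<+⇒ h)

-- Reciprocal square roots

-- A relation rather than a function, so that continuity and uniqueness depend neither on a
-- positivity proof nor on the chosen approximations.
record IsRsqrt (x v : ℝ) : Set where
  constructor mkIsRsqrt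
  field
    approximates : ∀ {δ} → 0ℚ ℚ.< δ → ∃[ k ] ∀ n → k ℕ.≤ n → Rsqrt δ (seq x n) (seq v n)

open IsRsqrt

abstract
  private
    approximate : ∀ q n → ∃[ v ] (0ℚ ℚ.< q → Rsqrt (1/suc n) q v)
    approximate q n with 0ℚ ℚ.<? q
    ... | yes 0<q = let v , v-is = rsqrt-approx 0<q (0<1/suc n) in v , λ _ → v-is
    -- Default value; for a positive real it can occur only at early indices, before the sequence
    -- stays above its gap.
    ... | no  0≮q = 0ℚ , λ 0<q → contradiction 0<q 0≮q

    approximation : ℚ → ℕ → ℚ
    approximation q n = proj₁ (approximate q n)

    approximation-Rsqrt : ∀ {q δ} n → 0ℚ ℚ.< q → 1/suc n ℚ.≤ δ → Rsqrt δ q (approximation q n)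
    approximation-Rsqrt {q} n 0<q ≤δ = rsqrt-weaken ≤δ (proj₂ (approximate q n) 0<q)

    approximation-cauchy : ∀ {x} → 0ℝ < x → IsCauchy (λ n → approximation (seq x n) n)
    approximation-cauchy {x} 0<x = λ ε 0<ε →
      let g , 0<g , i , p    = to-gap 0<x
          δ , 0<δ , stable   = rsqrt-stable 0<g (0<½* 0<ε)
          j , q              = 1/suc→0 0<δ
          k , r              = cauchy x δ 0<δ
          approx : ∀ {n} → (i ℕ.⊔ j) ℕ.⊔ k ℕ.≤ n → Rsqrt δ (seq x n) (approximation (seq x n) n)
          approx {n} n≥ = approximation-Rsqrt n
            (ℚ.<-≤-trans 0<g (p n (⊔≤ˡ {i} {j} (⊔≤ˡ n≥)))) (q n (⊔≤ʳ {i} {j} (⊔≤ˡ n≥)))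
      in (i ℕ.⊔ j) ℕ.⊔ k , λ m n m≥ n≥ → ℚ.≤-<-trans
        (stable (p m (⊔≤ˡ {i} {j} (⊔≤ˡ m≥))) (p n (⊔≤ˡ {i} {j} (⊔≤ˡ n≥))) (approx m≥) (approx n≥)
          (ℚ.<⇒≤ (r m n (⊔≤ʳ {i ℕ.⊔ j} m≥) (⊔≤ʳ {i ℕ.⊔ j} n≥))))
        (½*< 0<ε)

  1/√ : ∀ x → 0ℝ < x → ℝ
  1/√ x 0<x = mkℝ (λ n → approximation (seq x n) n) (approximation-cauchy 0<x)

  1/√-isRsqrt : ∀ x 0<x → IsRsqrt x (1/√ x 0<x)
  1/√-isRsqrt x 0<x = mkIsRsqrt λ 0<δ →
    let g , 0<g , j , p = to-gap 0<x
        k , q           = 1/suc→0 0<δ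
    in j ℕ.⊔ k , λ n n≥ → approximation-Rsqrt n (ℚ.<-≤-trans 0<g (p n (⊔≤ˡ n≥))) (q n (⊔≤ʳ n≥))

1-isRsqrt : IsRsqrt 1ℝ 1ℝ
1-isRsqrt = mkIsRsqrt λ 0<δ → 0 , λ _ _ →
  rsqrt (ℚ.<⇒≤ 0<1) ℚ.≤-refl (≤-by (ℚ.<⇒≤ 0<δ) refl)

-- Where x ≥ g, taking the modulus at most g/2 keeps x′ at or above g/2, so `rsqrt-stable` applies
-- with γ = g/2.
isRsqrt-Close : ∀ {x v ε} → 0ℝ < x → IsRsqrt x v → 0ℚ ℚ.< ε → ∃[ δ ] 0ℚ ℚ.< δ × (∀ {x′ v′} →
  IsRsqrt x′ v′ → Close δ x x′ → Close ε v v′)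
isRsqrt-Close {x} {v} 0<x v-is 0<ε =
  let g , 0<g , i , p  = to-gap 0<x
      δ , 0<δ , stable = rsqrt-stable (0<½* 0<g) 0<ε
      j , q            = approximates v-is 0<δ
  in δ ℚ.⊓ (½ ℚ.* g) , 0<⊓ 0<δ (0<½* 0<g) , λ {x′} v′-is (mkClose k r) →
    let l , q′ = approximates v′-is 0<δ in
    mkClose ((i ℕ.⊔ j) ℕ.⊔ (k ℕ.⊔ l)) λ n n≥ →
      let n≥i = ⊔≤ˡ {i} {j} (⊔≤ˡ n≥)
          n≥j = ⊔≤ʳ {i} {j} (⊔≤ˡ n≥)
          n≥k = ⊔≤ˡ {k} {l} (⊔≤ʳ {i ℕ.⊔ j} n≥)
          n≥l = ⊔≤ʳ {k} {l} (⊔≤ʳ {i ℕ.⊔ j} n≥)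
          x~  = ∣-∣≤⇒≤+ {seq x n} {seq x′ n} (ℚ.≤-trans (r n n≥k) (ℚ.p⊓q≤q δ (½ ℚ.* g)))
      in stable (ℚ.≤-trans (ℚ.<⇒≤ (½*< 0<g)) (p n n≥i))
           (≤-by (0≤+ (0≤- (p n n≥i)) (0≤- x~))
             (solve 3 (λ g x x′ → con ½ :* g :+ ((x :- g) :+ (x′ :+ con ½ :* g :- x)) := x′)
               refl g (seq x n) (seq x′ n)))
           (q n n≥j) (q′ n n≥l) (ℚ.≤-trans (r n n≥k) (ℚ.p⊓q≤p δ (½ ℚ.* g)))

isRsqrt-cong : ∀ {x x′ v v′} → 0ℝ < x → IsRsqrt x v → IsRsqrt x′ v′ → x ≈ x′ → v ≈ v′
isRsqrt-cong 0<x v-is v′-is x≈x′ = Close⇒≈ λ 0<ε →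
  let δ , 0<δ , close = isRsqrt-Close 0<x v-is 0<ε in close v′-is (≈⇒Close 0<δ x≈x′)

isRsqrt⇒*≈1 : ∀ {x v} → IsRsqrt x v → x * (v * v) ≈ 1ℝ
isRsqrt⇒*≈1 {x} {v} v-is = Close⇒≈ λ {ε} 0<ε → let k , p = approximates v-is 0<ε in
  mkClose k λ n k≤n → ≤+⇒∣-∣≤ (ℚ.≤-trans (Rsqrt.hi (p n k≤n)) (≤-by (ℚ.<⇒≤ 0<ε) refl)) (Rsqrt.lo (p n k≤n))

-- For q ≤ B and v < β ≤ 1 we would have ½ ≤ q v² ≤ B v < (B + 1) β = ½.
isRsqrt⇒0< : ∀ {x v} → IsRsqrt x v → 0ℝ < v
isRsqrt⇒0< {x} {v} v-is =
  let B , 0≤B , j , p = eventuallyBounded x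
      k , q           = approximates v-is (ℚ.positive⁻¹ ½)
      β , 0<β , eq    = divide {B ℚ.+ 1ℚ} (ℚ.+-mono-≤-< 0≤B 0<1) (ℚ.positive⁻¹ ½)
  in from-gap (β ℚ.⊓ 1ℚ) (0<⊓ 0<β 0<1) (j ℕ.⊔ k) λ n n≥ →
    bound 0≤B 0<β eq (ℚ.≤-trans (p≤∣p∣ (seq x n)) (p n (⊔≤ˡ n≥))) (q n (⊔≤ʳ n≥))
  where
  bound : ∀ {B β q v} → 0ℚ ℚ.≤ B → 0ℚ ℚ.< β → (B ℚ.+ 1ℚ) ℚ.* β ≡ ½ → q ℚ.≤ B → Rsqrt ½ q v → β ℚ.⊓ 1ℚ ℚ.≤ v
  bound {B} {β} {q} {v} 0≤B 0<β eq q≤B (rsqrt 0≤v hi lo) with β ℚ.⊓ 1ℚ ℚ.≤? v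
  ... | yes ≤v = ≤v
  ... | no ≰v = contradiction (<-by 0<β (trans
          (solve 2 (λ B β → B :* β :+ β := (B :+ con 1ℚ) :* β) refl B β) eq))
          (λ Bβ<½ → ℚ.<-irrefl refl (ℚ.≤-<-trans ½≤Bβ Bβ<½))
    where
    v≤ = ℚ.<⇒≤ (ℚ.≰⇒> ≰v)
    ½≤Bβ : ½ ℚ.≤ B ℚ.* β
    ½≤Bβ = ≤-by (0≤+ (0≤+ (0≤+ (0≤- lo) (0≤* (0≤- q≤B) (0≤² v)))
                     (0≤* (0≤* 0≤B 0≤v) (0≤- (ℚ.≤-trans v≤ (ℚ.p⊓q≤q β 1ℚ)))))
                     (0≤* 0≤B (0≤- (ℚ.≤-trans v≤ (ℚ.p⊓q≤p β 1ℚ)))))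
      (solve 4 (λ B β q v → con ½ :+ ((q :* (v :* v) :+ con ½ :- con 1ℚ) :+ (B :- q) :* (v :* v)
         :+ B :* v :* (con 1ℚ :- v) :+ B :* (β :- v)) := B :* β) refl B β q v)

-- Continuity

module _ (X : Space) where

  CloseBy : ℚ → Point X → Point X → Set
  CloseBy δ x y = ∀ i → Close δ (coord X x i) (coord X y i)

  -- The rational ε-δ form, in which sums, products and compositions are handled; `continuous`
  -- translates it to `Continuous`.
  ContinuousFn : (Point X → ℝ) → Set
  ContinuousFn φ = ∀ x {ε} → 0ℚ ℚ.< ε → ∃[ δ ] 0ℚ ℚ.< δ × (∀ y → CloseBy δ x y → Close ε (φ x) (φ y))

module _ {X : Space} where

  coord-cont : ∀ i → ContinuousFn X (λ x → coord X x i)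
  coord-cont i x 0<ε = _ , 0<ε , λ y x~y → x~y i

  const-cont : ∀ c → ContinuousFn X (λ _ → c)
  const-cont c x 0<ε = 1ℚ , 0<1 , λ _ _ → ≈⇒Close 0<ε ≈-refl

  +-cont : ∀ {φ ψ} → ContinuousFn X φ → ContinuousFn X ψ → ContinuousFn X (λ x → φ x + ψ x)
  +-cont {φ} {ψ} φ-cont ψ-cont x {ε} 0<ε =
    let δ , 0<δ , close  = φ-cont x (0<½* 0<ε)
        η , 0<η , close′ = ψ-cont x (0<½* 0<ε)
    in δ ℚ.⊓ η , 0<⊓ 0<δ 0<η , λ y x~y →
      subst (λ e → Close e (φ x + ψ x) (φ y + ψ y)) (½*+½* ε)
        (+-Close (close y (λ i → Close-mono (ℚ.p⊓q≤p δ η) (x~y i)))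
                 (close′ y (λ i → Close-mono (ℚ.p⊓q≤q δ η) (x~y i))))

  neg-cont : ∀ {φ} → ContinuousFn X φ → ContinuousFn X (λ x → - φ x)
  neg-cont φ-cont x 0<ε = let δ , 0<δ , close = φ-cont x 0<ε in δ , 0<δ , λ y x~y → neg-Close (close y x~y)

  minus-cont : ∀ {φ ψ} → ContinuousFn X φ → ContinuousFn X ψ → ContinuousFn X (λ x → φ x - ψ x)
  minus-cont φ-cont ψ-cont = +-cont φ-cont (neg-cont ψ-cont)

  *-cont : ∀ {φ ψ} → ContinuousFn X φ → ContinuousFn X ψ → ContinuousFn X (λ x → φ x * ψ x)
  *-cont {φ} {ψ} φ-cont ψ-cont x 0<ε =
    let ε′ , 0<ε′ , *-close = *-Close (φ x) (ψ x) 0<ε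
        δ , 0<δ , close     = φ-cont x 0<ε′
        η , 0<η , close′    = ψ-cont x 0<ε′
    in δ ℚ.⊓ η , 0<⊓ 0<δ 0<η , λ y x~y →
      *-close (close y (λ i → Close-mono (ℚ.p⊓q≤p δ η) (x~y i)))
              (close′ y (λ i → Close-mono (ℚ.p⊓q≤q δ η) (x~y i)))

  sum-cont : ∀ {n} {φ : Fin n → Point X → ℝ} → (∀ i → ContinuousFn X (φ i)) →
    ContinuousFn X (λ x → sum (λ i → φ i x))
  sum-cont {zero}  φ-cont = const-cont 0ℝ
  sum-cont {suc n} φ-cont = +-cont (φ-cont zero) (sum-cont (φ-cont ∘ suc))

  isRsqrt-cont : ∀ {φ ψ} → (∀ x → 0ℝ < φ x) → (∀ x → IsRsqrt (φ x) (ψ x)) →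
    ContinuousFn X φ → ContinuousFn X ψ
  isRsqrt-cont 0<φ ψ-is φ-cont x 0<ε =
    let ε′ , 0<ε′ , ψ-close = isRsqrt-Close (0<φ x) (ψ-is x) 0<ε
        δ , 0<δ , close     = φ-cont x 0<ε′
    in δ , 0<δ , λ y x~y → ψ-close (ψ-is y) (close y x~y)

⊗-contˡ : ∀ {X Y φ} → ContinuousFn X φ → ContinuousFn (X ⊗ Y) (φ ∘ proj₁)
⊗-contˡ φ-cont (x , _) 0<ε = let δ , 0<δ , close = φ-cont x 0<ε in
  δ , 0<δ , λ (y , _) x~y → close y (x~y ∘ inj₁)

-- The only consequence of finiteness of the index set that continuity needs.
UniformModulus : Set → Set₁
UniformModulus I = ∀ (P : I → ℚ → Set) → (∀ {i δ ε} → δ ℚ.≤ ε → P i ε → P i δ) →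
  (∀ i → ∃[ δ ] 0ℚ ℚ.< δ × P i δ) → ∃[ δ ] 0ℚ ℚ.< δ × (∀ i → P i δ)

uniformModulus-Fin : ∀ n → UniformModulus (Fin n)
uniformModulus-Fin zero    P mono h = 1ℚ , 0<1 , λ ()
uniformModulus-Fin (suc n) P mono h =
  let δ , 0<δ , p = h zero
      η , 0<η , q = uniformModulus-Fin n (P ∘ suc) mono (h ∘ suc)
  in δ ℚ.⊓ η , 0<⊓ 0<δ 0<η , λ
    { zero → mono (ℚ.p⊓q≤p δ η) p ; (suc i) → mono (ℚ.p⊓q≤q δ η) (q i) }

uniformModulus-× : ∀ {I J} → UniformModulus I → UniformModulus J → UniformModulus (I × J)
uniformModulus-× uI uJ P mono h =
  let δ , 0<δ , p = uI (λ i δ → ∀ j → P (i , j) δ) (λ δ≤ε p j → mono δ≤ε (p j))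
                      (λ i → uJ (λ j → P (i , j)) mono (λ j → h (i , j)))
  in δ , 0<δ , λ (i , j) → p i j

<fromℚ⇒ : ∀ {x y δ} → x - y < fromℚ δ → ∃[ k ] ∀ n → k ℕ.≤ n → seq x n ℚ.≤ seq y n ℚ.+ δ
<fromℚ⇒ {x} {y} {δ} (mk< g 0<g k p) = k , λ n k≤n →
  ≤-by (0≤+ (0≤- (p n k≤n)) (ℚ.<⇒≤ 0<g))
    (solve 4 (λ x y g d → x :+ ((d :- ((x :- y) :+ g)) :+ g) := y :+ d) refl (seq x n) (seq y n) g δ)

-- Half of the lower bound g of ε is spent on closeness; the other half is the gap that `_<_`
-- demands.
Close⇒< : ∀ {x y g ε} k → 0ℚ ℚ.< g → (∀ n → k ℕ.≤ n → g ℚ.≤ seq ε n) → Close (½ ℚ.* g) x y → x - y < ε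
Close⇒< {x} {y} {g} {ε} k 0<g p (mkClose j q) = mk< (½ ℚ.* g) (0<½* 0<g) (j ℕ.⊔ k) λ n n≥ →
  ≤-by (0≤+ (0≤- (∣-∣≤⇒≤+ {seq x n} {seq y n} (q n (⊔≤ˡ n≥)))) (0≤- (p n (⊔≤ʳ n≥))))
    (solve 4 (λ x y g e → (x :- y) :+ con ½ :* g :+ ((y :+ con ½ :* g :- x) :+ (e :- g)) := e)
      refl (seq x n) (seq y n) g (seq ε n))

-- The real ε is replaced by a positive rational g below it, `uniform` merges the moduli of the
-- coordinates into one rational, and its image in ℝ is the required δ.
continuous : ∀ X Y → UniformModulus (Index Y) → (f : Point X → Point Y) →
  (∀ i → ContinuousFn X (λ x → coord Y (f x) i)) → Continuous X Y f
continuous X Y uniform f f-cont x ε 0<ε =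
  let g , 0<g , k , p = to-gap 0<ε
      δ , 0<δ , close = uniform
        (λ i δ → ∀ y → CloseBy X δ x y → Close (½ ℚ.* g) (coord Y (f x) i) (coord Y (f y) i))
        (λ δ≤ε c y x~y → c y (λ i → Close-mono δ≤ε (x~y i)))
        (λ i → f-cont i x (0<½* 0<g))
  in fromℚ δ , from-gap δ 0<δ 0 (λ _ _ → ℚ.≤-refl) , λ y x~y i →
    let c = close i y λ j → let k , p = <fromℚ⇒ (proj₁ (x~y j))
                                l , q = <fromℚ⇒ (proj₂ (x~y j)) in
              mkClose (k ℕ.⊔ l) λ n n≥ → ≤+⇒∣-∣≤ (p n (⊔≤ˡ n≥)) (q n (⊔≤ʳ n≥))
    in Close⇒< k 0<g p c , Close⇒< k 0<g p (Close-sym c)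

-- The equivariant map

-- Pigeonhole: if each of the n + 1 rows held a vertex in one of the n columns `suc c`, two rows
-- would share a column.
rowUsingOnlyColumn0 : ∀ {n σ} → IsSimplex (chessboard (suc n) (suc n)) σ →
  ∃[ i ] ∀ c → ¬ ((i , suc c) ∈ σ)
rowUsingOnlyColumn0 {n} {σ} simplex with Fin.any? (λ i → ¬? (Fin.any? λ c → T? (σ (i , suc c))))
... | yes (i , none) = i , λ c ic∈σ → none (c , ic∈σ)
... | no all-used =
  let i , j , i<j , fi≡fj = Fin.pigeonhole ℕ.≤-refl (proj₁ ∘ used)
      _ , columns≢ = simplex _ _ (proj₂ (used i)) (proj₂ (used j)) (Fin.<⇒≢ i<j ∘ cong proj₁)
  in contradiction (cong suc fi≡fj) columns≢
  where
  used : ∀ i → ∃[ c ] (i , suc c) ∈ σ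
  used i = decidable-stable (Fin.any? λ c → T? (σ (i , suc c))) λ none → all-used (i , none)

module _ {n k : ℕ} where

  private
    K = joinPower (chessboard (suc (suc n)) (suc (suc n))) k

  signedRowSum : Point ∣ K ∣ → Fin (suc (suc n)) → Fin k → ℝ
  signedRowSum x i j = weight x (j , i , zero) - sum (λ c → weight x (j , i , suc c))

  -- This is r times the projection to W_r, r being the number of rows; the factor avoids dividing
  -- by r in the mean.
  centred : Point ∣ K ∣ → Fin (suc (suc n)) → Fin k → ℝ
  centred x i j = sum (λ l → signedRowSum x i j - signedRowSum x l j)

  -- After splitting the differences, exchanging the order of summation turns the first double sum
  -- into the second.
  centred-columnSums : ∀ x j → sum (λ i → centred x i j) ≈ 0ℝ
  centred-columnSums x j = ≈-trans
    (sum-cong (λ i → centred x i j) (λ i → sum {suc (suc n)} (λ _ → S i) - sum S)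
      λ i → sum-minus (λ _ → S i) S)
    (≈-trans (sum-minus (λ i → sum {suc (suc n)} λ _ → S i) (λ _ → sum S))
      (≈-trans (minus-cong (∑-comm (λ i (_ : Fin (suc (suc n))) → S i)) ≈-refl)
        (pointwise λ m → ℚ.+-inverseʳ (seq (sum {suc (suc n)} λ _ → sum S) m))))
    where
    S = λ i → signedRowSum x i j

  -- The centred entries of two rows differ by r times the difference of their signed sums, so by
  -- `0<+⇒` the first entry is positive or the second negative.
  centred-#0 : ∀ x {i i′ j} → 0ℝ < signedRowSum x i j - signedRowSum x i′ j →
    ∃[ l ] ∃[ j ] centred x l j # 0ℝ
  centred-#0 x {i} {i′} {j} h =
    [ (λ 0<i → i , j , inj₂ 0<i) , (λ 0<-i′ → i′ , j , inj₁ (0<-⇒<0 0<-i′)) ]′ (0<+⇒ difference)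
    where
    S = λ i → signedRowSum x i j
    difference : 0ℝ < centred x i j - centred x i′ j
    difference = 0<-resp-≈
      (≈-trans
        (sum-cong (λ _ → S i - S i′) (λ l → (S i - S l) - (S i′ - S l)) λ l → pointwise λ m →
          solve 3 (λ a b c → a :- b := (a :- c) :- (b :- c)) refl (seq (S i) m) (seq (S i′) m) (seq (S l) m))
        (sum-minus (λ l → S i - S l) (λ l → S i′ - S l)))
      (sum-pos {f = λ _ → S i - S i′} (λ _ → <⇒0≤ h) (zero {suc n}) h)

  module _ (x : Point ∣ K ∣) (j : Fin k) where
    private
      w : Fin (suc (suc n)) → Fin (suc (suc n)) → ℝ
      w i c = weight x (j , i , c)

      vanishes : ∀ {i c} → ¬ ((j , i , c) ∈ carrier x) → w i c ≈ 0ℝ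
      vanishes = supported x _

      sum-vanishes : ∀ {i} → (∀ c → ¬ ((j , i , suc c) ∈ carrier x)) → sum (w i ∘ suc) ≈ 0ℝ
      sum-vanishes {i} ∉ = ≈-trans (sum-cong (w i ∘ suc) (λ _ → 0ℝ) (vanishes ∘ ∉)) (sum-replicate-zero (suc n))

      -- Shaped for two signed row sums: p and b are weights in column 0, a and q sums over the
      -- other columns, and a and b vanish.
      difference : ∀ {p a b q} → a ≈ 0ℝ → b ≈ 0ℝ → 0ℝ < p + q → 0ℝ < (p - a) - (b - q)
      difference {p} {a} {b} {q} a≈0 b≈0 = 0<-resp-≈
        (≈-trans
          (pointwise λ m → solve 2 (λ p q → p :+ q := (p :- con 0ℚ) :- (con 0ℚ :- q)) refl
            (seq p m) (seq q m))
          (minus-cong (minus-cong ≈-refl (≈-sym a≈0)) (minus-cong (≈-sym b≈0) ≈-refl)))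

      otherColumn : ∀ {i c c′} → (j , i , c) ∈ carrier x → c ≢ c′ → ¬ ((j , i , c′) ∈ carrier x)
      otherColumn ic∈ c≢c′ ic′∈ = proj₁ (isSimplex x j _ _ ic∈ ic′∈ (c≢c′ ∘ cong proj₂)) refl

      otherRow : ∀ {i i′ c} → (j , i , c) ∈ carrier x → i ≢ i′ → ¬ ((j , i′ , c) ∈ carrier x)
      otherRow ic∈ i≢i′ i′c∈ = proj₂ (isSimplex x j _ _ ic∈ i′c∈ (i≢i′ ∘ cong proj₁)) refl

      another : (i : Fin (suc (suc n))) → ∃[ i′ ] i ≢ i′
      another zero    = suc zero , λ ()
      another (suc i) = zero , λ ()

    distinctRows : ∀ i c → 0ℝ < w i c → ∃[ i ] ∃[ i′ ] 0ℝ < signedRowSum x i j - signedRowSum x i′ j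
    -- Membership in the carrier is decidable, and a vertex outside it has weight 0.
    distinctRows i c 0<w with T? (carrier x (j , i , c))
    ... | no  ∉carrier = contradiction (0<-resp-≈ (vanishes ∉carrier) 0<w) ¬0<0
    -- Row i has only its column 0 weight, while any other row has none in column 0.
    distinctRows i zero 0<w | yes ∈carrier = let i′ , i≢i′ = another i in
      i , i′ , difference (sum-vanishes λ c → otherColumn ∈carrier λ ()) (vanishes (otherRow ∈carrier i≢i′))
        (+-pos-nonNeg 0<w (sum-nonNeg λ c → nonNegative x (j , i′ , suc c)))
    -- Row i has no weight in column 0, and the row supplied by pigeonhole has none elsewhere.
    distinctRows i (suc c) 0<w | yes ∈carrier = let i′ , free = rowUsingOnlyColumn0 (isSimplex x j) in
      i′ , i , difference (sum-vanishes free) (vanishes (otherColumn ∈carrier λ ()))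
        (+-nonNeg-pos (nonNegative x (j , i′ , zero))
          (sum-pos (λ c → nonNegative x (j , i , suc c)) c 0<w))

  equivariantMap : Point ∣ K ∣ → Point (W^⊕ suc (suc n) ∖0 k)
  equivariantMap x = record
    { entry      = centred x
    ; columnSums = centred-columnSums x
    ; nonzero    =
        let l , 0<weight = 0<sum⇒ (weight x ∘ Inverse.to (enum K)) (0<-resp-≈ (≈-sym (total x)) 0<1ℝ)
            j , i , c    = Inverse.to (enum K) l
            _ , _ , 0<   = distinctRows x j i c 0<weight
        in centred-#0 x 0<
    }

  equivariantMap-continuous : Continuous ∣ K ∣ (W^⊕ suc (suc n) ∖0 k) equivariantMap
  equivariantMap-continuous = continuous ∣ K ∣ (W^⊕ suc (suc n) ∖0 k)
    (uniformModulus-× (uniformModulus-Fin (suc (suc n))) (uniformModulus-Fin k)) equivariantMap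
    λ (i , j) → sum-cont λ l → minus-cont (signed i j) (signed l j)
    where
    signed : ∀ i j → ContinuousFn ∣ K ∣ (λ x → signedRowSum x i j)
    signed i j = minus-cont (coord-cont (j , i , zero)) (sum-cont λ c → coord-cont (j , i , suc c))

  -- The signed sums of the moved point are, by computation, those of the rows π⁻¹ i; only the
  -- summation over l is left to reindex.
  equivariantMap-equivariant : Equivariant equivariantMap
  equivariantMap-equivariant π x (i , j) =
    ≈-sym (sum-permute (λ l → signedRowSum x (π ⟨$⟩ˡ i) j - signedRowSum x l j) (↔-sym π))

-- The homotopy equivalence

module _ (m k : ℕ) where

  private
    N = m ℕ.* k
    W = W^⊕ suc m ∖0 k
    S = UnitSphere N

  lower : Point W → Fin N → ℝ
  lower M l = let i , j = remQuot k l in entry M (suc i) j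

  normSq : Point W → ℝ
  normSq M = sum λ l → lower M l * lower M l

  -- A column whose top entry is nonzero has another nonzero entry, since its sum is zero.
  lowerNonzero : ∀ (M : Point W) → ∃[ i ] ∃[ j ] entry M (suc i) j # 0ℝ
  lowerNonzero M = cases (nonzero M)
    where
    cases : (∃[ i ] ∃[ j ] entry M i j # 0ℝ) → ∃[ i ] ∃[ j ] entry M (suc i) j # 0ℝ
    cases (suc i , j , e#0) = i , j , e#0
    cases (zero , j , inj₁ e<0) =
      let i , 0<ei = 0<sum⇒ below (0<-resp-≈
            (≈-trans (≈-trans (pointwise λ n → sym (ℚ.+-identityˡ (ℚ.- seq top n)))
                (minus-cong (≈-sym (columnSums M j)) (≈-refl {top})))
              (pointwise λ n → solve 2 (λ a b → (a :+ b) :- a := b) refl (seq top n) (seq (sum below) n)))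
            (<0⇒0<- e<0))
      in i , j , inj₂ 0<ei
      where
      top = entry M zero j
      below = λ i → entry M (suc i) j
    cases (zero , j , inj₂ 0<e) =
      let i , 0<-ei = 0<sum⇒ (λ i → - below i) (0<-resp-≈
            (≈-trans (≈-trans (pointwise λ n → sym (ℚ.+-identityʳ (seq top n)))
                (minus-cong (≈-refl {top}) (≈-sym (columnSums M j))))
              (≈-trans (pointwise λ n → solve 2 (λ a b → a :- (a :+ b) := :- b) refl (seq top n) (seq (sum below) n))
                (≈-sym (sum-neg below))))
            0<e)
      in i , j , inj₁ (0<-⇒<0 0<-ei)
      where
      top = entry M zero j
      below = λ i → entry M (suc i) j

  0<normSq : ∀ M → 0ℝ < normSq M
  0<normSq M = let i , j , e#0 = lowerNonzero M in
    sum-pos {f = λ l → lower M l * lower M l} (λ l → ²-nonNeg (lower M l)) (combine i j)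
      (subst (λ (i , j) → 0ℝ < entry M (suc i) j * entry M (suc i) j)
        (sym (Fin.remQuot-combine i j)) (#0⇒0<² e#0))

  1/norm : Point W → ℝ
  1/norm M = 1/√ (normSq M) (0<normSq M)

  1/norm-isRsqrt : ∀ M → IsRsqrt (normSq M) (1/norm M)
  1/norm-isRsqrt M = 1/√-isRsqrt (normSq M) (0<normSq M)

  toSphere : Point W → Point S
  toSphere M = (λ l → lower M l * 1/norm M) , ≈-trans
    (≈-trans
      (sum-cong _ (λ l → lower M l * lower M l * (1/norm M * 1/norm M)) λ l → pointwise λ n →
        solve 2 (λ e u → e :* u :* (e :* u) := e :* e :* (u :* u)) refl (seq (lower M l) n) (seq (1/norm M) n))
      (sum-*ʳ (λ l → lower M l * lower M l) (1/norm M * 1/norm M)))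
    (isRsqrt⇒*≈1 (1/norm-isRsqrt M))

  fromSphere : Point S → Point W
  fromSphere (y , ∣y∣²≈1) = record
    -- Row 0 is forced by the vanishing column sums.
    { entry      = λ { zero j → - sum {m} (λ i → y (combine i j)) ; (suc i) j → y (combine i j) }
    ; columnSums = λ j → pointwise λ n → ℚ.+-inverseˡ (seq (sum {m} λ i → y (combine i j)) n)
    ; nonzero    =
        let l , 0<y² = 0<sum⇒ (λ l → y l * y l) (0<-resp-≈ (≈-sym ∣y∣²≈1) 0<1ℝ)
            i , j    = remQuot {m} k l
        in suc i , j , subst (λ l → y l # 0ℝ) (sym (Fin.combine-remQuot {m} k l)) (0<²⇒#0 0<y²)
    }

  scale : Point W → ∀ s → 0ℝ < s → Point W
  scale M s 0<s = record
    { entry      = λ i j → entry M i j * s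
    ; columnSums = λ j → ≈-trans (sum-*ʳ (λ i → entry M i j) s)
        (≈-trans (*-cong (columnSums M j) (≈-refl {s})) (pointwise λ n → ℚ.*-zeroˡ (seq s n)))
    ; nonzero    = let i , j , e#0 = nonzero M in i , j , *-#0 e#0 0<s
    }

  -- The squares make the factor positive for every real t.
  factor : Point W → ℝ → ℝ
  factor M t = (1ℝ - t) * (1ℝ - t) * 1/norm M + t * t

  0<factor : ∀ M t → 0ℝ < factor M t
  0<factor M t =
    -- One of t and 1 - t is positive because they add up to 1, and either makes one summand of the
    -- factor positive.
    [ (λ 0<t → +-nonNeg-pos (²*-nonNeg (1ℝ - t) 0<u) (*-pos 0<t 0<t))
    , (λ 0<1-t → +-pos-nonNeg (*-pos (*-pos 0<1-t 0<1-t) 0<u) (²-nonNeg t))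
    ]′ (0<+⇒ {t} {1ℝ - t} (0<-resp-≈ (pointwise λ n →
         solve 1 (λ t → con 1ℚ := t :+ (con 1ℚ :- t)) refl (seq t n)) 0<1ℝ))
    where
    0<u = isRsqrt⇒0< (1/norm-isRsqrt M)

  homotopy : Point W × Point UnitInterval → Point W
  homotopy (M , t , _) = scale M (factor M t) (0<factor M t)

  uniformW : UniformModulus (Index W)
  uniformW = uniformModulus-× (uniformModulus-Fin (suc m)) (uniformModulus-Fin k)

  lower-cont : ∀ l → ContinuousFn W (λ M → lower M l)
  lower-cont l = coord-cont (suc (proj₁ (remQuot {m} k l)) , proj₂ (remQuot {m} k l))

  1/norm-cont : ContinuousFn W 1/norm
  1/norm-cont = isRsqrt-cont 0<normSq 1/norm-isRsqrt (sum-cont λ l → *-cont (lower-cont l) (lower-cont l))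

  toSphere-continuous : Continuous W S toSphere
  toSphere-continuous = continuous W S (uniformModulus-Fin N) toSphere λ l →
    *-cont (lower-cont l) 1/norm-cont

  fromSphere-continuous : Continuous S W fromSphere
  fromSphere-continuous = continuous S W uniformW fromSphere λ
    { (zero  , j) → neg-cont (sum-cont {n = m} λ i → coord-cont (combine i j))
    ; (suc i , j) → coord-cont (combine i j) }

  homotopy-continuous : Continuous (W ⊗ UnitInterval) W homotopy
  homotopy-continuous = continuous (W ⊗ UnitInterval) W uniformW homotopy λ ij → *-cont (coord-cont (inj₁ ij))
    (+-cont (*-cont (*-cont 1-t 1-t) (⊗-contˡ {W} {UnitInterval} 1/norm-cont)) (*-cont t t))
    where
    t : ContinuousFn (W ⊗ UnitInterval) (λ (_ , t , _) → t)
    t = coord-cont {W ⊗ UnitInterval} (inj₂ _)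
    1-t : ContinuousFn (W ⊗ UnitInterval) (λ (_ , t , _) → 1ℝ - t)
    1-t = minus-cont (const-cont 1ℝ) t

  -- Going to the sphere and back only rescales by `1/norm`: the lower rows are scaled directly, and
  -- row 0 follows from the column sums.
  homotopy-0 : ∀ M → Space._≋_ W (homotopy (M , 0ᴵ)) (fromSphere (toSphere M))
  homotopy-0 M (i , j) = ≈-trans
    (*-cong (≈-refl {entry M i j}) (pointwise λ n →
      solve 1 (λ u → (con 1ℚ :- con 0ℚ) :* (con 1ℚ :- con 0ℚ) :* u :+ con 0ℚ :* con 0ℚ := u) refl (seq u n)))
    (entries i)
    where
    u = 1/norm M
    lower-combine : ∀ i → lower M (combine i j) ≡ entry M (suc i) j
    lower-combine i = cong (λ (i , j) → entry M (suc i) j) (Fin.remQuot-combine i j)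
    entries : ∀ i → entry M i j * u ≈ entry (fromSphere (toSphere M)) i j
    entries (suc i) = pointwise λ n → cong (λ e → seq e n ℚ.* seq u n) (sym (lower-combine i))
    entries zero = ≈-trans
      (≈-trans (*-cong top≈ (≈-refl {u})) (pointwise λ n → sym (ℚ.neg-distribˡ-* (seq (sum below) n) (seq u n))))
      (neg-cong (≈-trans (≈-sym (sum-*ʳ below u))
        (sum-cong {m} (λ i → below i * u) (λ i → lower M (combine i j) * u) λ i →
          pointwise λ n → cong (λ e → seq e n ℚ.* seq u n) (sym (lower-combine i)))))
      where
      below = λ i → entry M (suc i) j
      top≈ : entry M zero j ≈ - sum below
      top≈ = ≈-trans
        (pointwise λ n → solve 2 (λ a b → a := (a :+ b) :- b) refl
          (seq (entry M zero j) n) (seq (sum below) n))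
        (≈-trans (minus-cong (columnSums M j) (≈-refl {sum below}))
          (pointwise λ n → ℚ.+-identityˡ (ℚ.- seq (sum below) n)))

  homotopy-1 : ∀ M → Space._≋_ W (homotopy (M , 1ᴵ)) M
  homotopy-1 M (i , j) = pointwise λ n → solve 2 (λ e u →
    e :* ((con 1ℚ :- con 1ℚ) :* (con 1ℚ :- con 1ℚ) :* u :+ con 1ℚ :* con 1ℚ) := e) refl
    (seq (entry M i j) n) (seq (1/norm M) n)

  -- The squared norm is 1 here, and 1 is its own reciprocal square root; by uniqueness the scaling
  -- factor is 1.
  toSphere∘fromSphere : ∀ y → Space._≋_ S y (toSphere (fromSphere y))
  toSphere∘fromSphere y@(f , ∣f∣²≈1) l = ≈-trans
    (pointwise λ n → trans (cong (λ l → seq (f l) n) (sym (Fin.combine-remQuot {m} k l))) (sym (ℚ.*-identityʳ _)))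
    (*-cong (≈-refl {lower (fromSphere y) l})
      (isRsqrt-cong 0<1ℝ 1-isRsqrt (1/norm-isRsqrt (fromSphere y)) 1≈normSq))
    where
    1≈normSq : 1ℝ ≈ normSq (fromSphere y)
    1≈normSq = ≈-trans (≈-sym ∣f∣²≈1) (sum-cong _ _ λ l → pointwise λ n →
      cong (λ l → seq (f l) n ℚ.* seq (f l) n) (sym (Fin.combine-remQuot {m} k l)))

  W∖0≃sphere : W ≃ S
  W∖0≃sphere = toSphere , fromSphere , toSphere-continuous , fromSphere-continuous ,
    (homotopy , homotopy-continuous , homotopy-0 , homotopy-1) ,
    -- The composite on the sphere is already the identity up to `_≋_`, so the constant homotopy
    -- serves.
    (proj₁ , continuous (S ⊗ UnitInterval) S (uniformModulus-Fin N) proj₁ (λ l → coord-cont (inj₁ l)) ,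
      toSphere∘fromSphere , (λ _ _ → ≈-refl))

proposition4p1 : ∀ (r d : ℕ) → 2 ℕ.≤ r → 1 ℕ.≤ d →
    let N = (r ∸ 1) ℕ.* (d ℕ.+ 1)
        X = ∣ joinPower (chessboard r r) (d ℕ.+ 1) ∣
        Y = W^⊕ r ∖0 (d ℕ.+ 1)
    in (Σ (Point X → Point Y) λ F → Continuous X Y F × Equivariant F) × (Y ≃ UnitSphere N)
proposition4p1 (suc zero) _ (ℕ.s≤s ()) _
proposition4p1 (suc (suc n)) d _ _ =
  (equivariantMap , equivariantMap-continuous , equivariantMap-equivariant) , W∖0≃sphere (suc n) (d ℕ.+ 1)
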